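{- Assume the 2-to-2 conjecture. Then for every $\varepsilon\ge1/2$ and $\delta>0$, no polynomial-time algorithm can distinguish with probability greater than $o(1)$ between the following two cases, given an instance of Unique Games: (Yes case) the instance is a $1-\varepsilon$ satisfiable semi-random instance generated in the "random edges, adversarial constraints" model with parameter $\varepsilon$; (No case) the instance is at most $\delta$ satisfiable.
   Context: Unique Games: an instance consists of a graph $G=(V,E)$, a label set $[k]=\{0,\dots,k-1\}$, and a permutation (constraint) $\pi_{uv}$ of $[k]$ for every edge $(u,v)\in E$; an assignment $x_u\in[k]$ satisfies $(u,v)$ if $x_v=\pi_{uv}(x_u)$. An instance is at most $\delta$ satisfiable if no assignment satisfies more than a $\delta$ fraction of the constraints. "Random edges, adversarial constraints" model with parameter $\varepsilon$: the adversary selects a graph $G=(V,E)$ and constraints $\{\pi_{uv}\}$ forming a completely satisfiable instance. Then every edge of $E$ is added to a set $E_\varepsilon$ independently with probability $\varepsilon$. Finally the adversary (knowing $E_\varepsilon$) replaces the constraint of every edge in $E_\varepsilon$ by a constraint of her choice (possibly the same one, and possibly chosen at random). The adversary is arbitrary (computationally unbounded). 2-to-2 game: given a graph $G=(V,E)$, a label set $[k]$ with $k$ even, and for every edge $(u,v)$ a predicate $\Pi_{uv}:[k]\times[k]\to\{0,1\}$ such that for every $i$ there are exactly two $j$ with $\Pi_{uv}(i,j)=1$ and for every $j$ there are exactly two $i$ with $\Pi_{uv}(i,j)=1$. The goal is to assign labels $x_u\in[k]$ so as to maximize the number of satisfied constraints $\Pi_{uv}(x_u,x_v)=1$. 2-to-2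 conjecture: for every $\delta>0$ and sufficiently large $k$, there is no polynomial-time algorithm that distinguishes between the cases (i) the 2-to-2 game instance is completely satisfiable and (ii) the 2-to-2 game instance is at most $\delta$ satisfiable (no assignment satisfies more than a $\delta$ fraction of constraints). "Distinguish with probability greater than $o(1)$" refers to the distinguishing advantage; algorithms may be randomized, and $o(1)$ tends to $0$ as the instance size grows. -}

module Defs where

open import Level using (Level; _⊔_) renaming (suc to lsuc)
open import Algebra.Apartness.Bundles using (HeytingField)
open import Data.Bool.Base using (Bool; true; false; if_then_else_)
open import Data.Fin.Base using (Fin; toℕ)
import Data.Fin.Base as Fin
import Data.Fin.Properties as Fin
open import Data.Fin.Permutation using (Permutation′; _⟨$⟩ʳ_)
open import Data.Fin.Subset using (Subset; ⊤; ∣_∣)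
open import Data.List.Base as List using (List; []; _∷_; _++_; concatMap; replicate; allFin)
open import Data.List.Relation.Unary.All using (All)
open import Data.Nat.Base using (ℕ; zero; suc; _+_; _^_; _≤_; _<_; _≥_)
open import Data.Nat.Divisibility using (_∣_)
open import Data.Product.Base using (Σ; Σ-syntax; ∃; ∃-syntax; _×_; _,_; proj₁; proj₂)
open import Data.Sum.Base using (_⊎_)
open import Data.Vec.Base as Vec using (Vec; []; _∷_; lookup; tabulate; _[_]≔_; _[_]%=_)
open import Relation.Binary.Core using (Rel)
open import Relation.Binary.PropositionalEquality using (_≡_)
open import Relation.Binary.Structures using (IsStrictPartialOrder)
open import Relation.Nullary using (¬_; does)

------------------------------------------------------------------------
-- The real numbers

natural : ∀ {c ℓ₁ ℓ₂} (F : HeytingField c ℓ₁ ℓ₂) → ℕ → HeytingField.Carrier F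
natural F zero    = HeytingField.0# F
natural F (suc n) = let open HeytingField F renaming (_+_ to _⊕_) in 1# ⊕ natural F n

-- Everything below is stated over an arbitrary Archimedean ordered field.
-- The axioms are constructive (cf. the HoTT book, Def. 11.2.7 and Sec. 11.2.1):
-- both ℚ and the usual constructions of ℝ satisfy them.  In particular the
-- order is not assumed decidable, and x ≤ y is defined as ¬ (y < x).

record ArchimedeanOrderedField c ℓ₁ ℓ₂ ℓ₃ : Set (lsuc (c ⊔ ℓ₁ ⊔ ℓ₂ ⊔ ℓ₃)) where
  field
    heytingField : HeytingField c ℓ₁ ℓ₂

  open HeytingField heytingField public
    renaming (_+_ to _+ᴿ_; _*_ to _*ᴿ_; _-_ to _-ᴿ_) hiding (-_)

  infix 4 _<ᴿ_ _≤ᴿ_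
  field
    _<ᴿ_                 : Rel Carrier ℓ₃
    isStrictPartialOrder : IsStrictPartialOrder _≈_ _<ᴿ_
    <⇒#                  : ∀ {x y} → x <ᴿ y → x # y
    #⇒<⊎>                : ∀ {x y} → x # y → (x <ᴿ y) ⊎ (y <ᴿ x)
    0<1                  : 0# <ᴿ 1#
    +-monoˡ-<            : ∀ {x y} z → x <ᴿ y → x +ᴿ z <ᴿ y +ᴿ z
    *-pos                : ∀ {x y} → 0# <ᴿ x → 0# <ᴿ y → 0# <ᴿ x *ᴿ y
    archimedean          : ∀ x → ∃[ n ] x <ᴿ natural heytingField n

  fromℕ : ℕ → Carrier
  fromℕ = natural heytingField

  _≤ᴿ_ : Rel Carrier ℓ₃
  x ≤ᴿ y = ¬ (y <ᴿ x)

  open IsStrictPartialOrder isStrictPartialOrder public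
    using (<-respʳ-≈; <-respˡ-≈) renaming (trans to <-trans; irrefl to <-irrefl)

  private
    0<2 : 0# <ᴿ 1# +ᴿ 1#
    0<2 = <-trans 0<1 (<-respˡ-≈ (+-identityˡ 1#) (+-monoˡ-< 1# 0<1))

  ½ : Carrier
  ½ = proj₁ (#⇒invertible (#-sym (<⇒# 0<2)))

------------------------------------------------------------------------
-- Randomized algorithms

-- Structured programs over finitely many stacks of bits; a tape of a
-- multitape Turing machine is a pair of stacks, so step counts agree with
-- multitape Turing machine time up to constant factors.
--   pop i p q r   pops stack i, then runs q / r if the bit popped is 0 / 1,
--                 or p if the stack was empty;
--   toss p q      runs p or q with probability 1/2 each;
--   while i p     repeats p as long as stack i is nonempty.

infixr 5 _⨾_

data Program (s : ℕ) : Set where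
  skip  : Program s
  push  : Fin s → Bool → Program s
  pop   : Fin s → Program s → Program s → Program s → Program s
  toss  : Program s → Program s → Program s
  _⨾_   : Program s → Program s → Program s
  while : Fin s → Program s → Program s

-- The programs still to be executed, and the contents of the stacks.
State : ℕ → Set
State s = List (Program s) × Vec (List Bool) s

-- As for probabilistic Turing machines, each step is supplied with a fair
-- coin, which only toss consults.
step : ∀ {s} → Bool → State s → State s
step b ([]            , σ) = [] , σ
step b (skip ∷ K      , σ) = K , σ
step b (push i c ∷ K  , σ) = K , σ [ i ]%= (c ∷_)
step b (pop i p q r ∷ K , σ) with lookup σ i
... | []        = p ∷ K , σ
... | false ∷ w = q ∷ K , σ [ i ]≔ w
... | true  ∷ w = r ∷ K , σ [ i ]≔ w
step b (toss p q ∷ K  , σ) = (if b then p else q) ∷ K , σ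
step b ((p ⨾ q) ∷ K   , σ) = p ∷ q ∷ K , σ
step b (while i p ∷ K , σ) with lookup σ i
... | []    = K , σ
... | _ ∷ _ = p ∷ while i p ∷ K , σ

run : ∀ {s t} → Vec Bool t → State s → State s
run []       S = S
run (b ∷ bs) S = run bs (step b S)

Algorithm : Set
Algorithm = Σ[ s ∈ ℕ ] Program (suc s)

-- The input is placed on the first stack.
initial : ∀ {s} → Program (suc s) → List Bool → State (suc s)
initial p input = p ∷ [] , input ∷ Vec.replicate _ []

HaltsWithin : Algorithm → ℕ → List Bool → Set
HaltsWithin (s , p) t input =
  (coins : Vec Bool t) → proj₁ (run coins (initial p input)) ≡ []

-- Accepting means having halted with a 1 on top of the first stack.
accepting : ∀ {s} → State (suc s) → Bool
accepting ([] , (true ∷ _) ∷ _) = true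
accepting _                     = false

accepts : (A : Algorithm) → List Bool → ∀ {t} → Vec Bool t → Bool
accepts (s , p) input coins = accepting (run coins (initial p input))

------------------------------------------------------------------------
-- Graphs, Unique Games and 2-to-2 games

-- A finite simple graph on the vertices Fin n with m edges.  The endpoints of
-- an edge are listed in increasing order; a constraint on the ordered pair
-- (u , v) determines the (inverse, transposed) constraint on (v , u).  There
-- is at least one edge, so that fractions of constraints are meaningful.
record Graph (n m : ℕ) : Set where
  field
    src tgt  : Fin m → Fin n
    src<tgt  : ∀ e → src e Fin.< tgt e
    simple   : ∀ e e′ → src e ≡ src e′ → tgt e ≡ tgt e′ → e ≡ e′
    nonempty : 0 < m

record UniqueGame : Set where
  field
    {n m k} : ℕ
    graph   : Graph n m
    π       : Fin m → Permutation′ k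
  open Graph graph public

  -- The edges e = (u , v) with x_v = π_uv(x_u).
  satisfied : (Fin n → Fin k) → Subset m
  satisfied x = tabulate λ e → does (x (tgt e) Fin.≟ π e ⟨$⟩ʳ x (src e))

record TwoToTwoGame (k : ℕ) : Set where
  field
    {n m}    : ℕ
    graph    : Graph n m
    Π        : Fin m → Fin k → Fin k → Bool
    two-to-r : ∀ e i → ∣ tabulate (λ j → Π e i j) ∣ ≡ 2
    two-to-l : ∀ e j → ∣ tabulate (λ i → Π e i j) ∣ ≡ 2
  open Graph graph public

  satisfied : (Fin n → Fin k) → Subset m
  satisfied x = tabulate λ e → Π e (x (src e)) (x (tgt e))

CompletelySatisfiable : ∀ {n m k} → ((Fin n → Fin k) → Subset m) → Set
CompletelySatisfiable satisfied = ∃[ x ] satisfied x ≡ ⊤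

-- Binary encodings, of length polynomial in n + m + k.

unary : ℕ → List Bool
unary a = replicate a true ++ false ∷ []

encodeGame : ∀ {n m} → ℕ → Graph n m → (Fin m → List Bool) → List Bool
encodeGame {n} {m} k G constraint =
  unary n ++ unary m ++ unary k ++
  concatMap (λ e → unary (toℕ (src e)) ++ unary (toℕ (tgt e)) ++ constraint e) (allFin m)
  where open Graph G

encodeUG : UniqueGame → List Bool
encodeUG I = encodeGame k graph λ e → concatMap (λ i → unary (toℕ (π e ⟨$⟩ʳ i))) (allFin k)
  where open UniqueGame I

encode22 : ∀ {k} → TwoToTwoGame k → List Bool
encode22 {k} I = encodeGame k graph λ e → concatMap (λ i → List.map (Π e i) (allFin k)) (allFin k)
  where open TwoToTwoGame I

-- Two readings of "distinguishes with advantage more than o(1)": the advantage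
-- is bounded below by a positive constant for all large sizes, or it is so for
-- infinitely many sizes (it does not tend to 0).
data Reading : Set where
  almostAllSizes infinitelyManySizes : Reading

------------------------------------------------------------------------

module _ {c ℓ₁ ℓ₂ ℓ₃} (ℝ : ArchimedeanOrderedField c ℓ₁ ℓ₂ ℓ₃) where
  open ArchimedeanOrderedField ℝ

  ----------------------------------------------------------------------
  -- Finite probability

  Weighted : Set → Set c
  Weighted X = List (Carrier × X)

  𝔼 : {X : Set} → Weighted X → (X → Carrier) → Carrier
  𝔼 []            f = 0#
  𝔼 ((w , x) ∷ D) f = w *ᴿ f x +ᴿ 𝔼 D f

  record Distribution (X : Set) : Set (c ⊔ ℓ₁ ⊔ ℓ₃) where
    field
      weighted : Weighted X
      nonneg   : All (λ wx → 0# ≤ᴿ proj₁ wx) weighted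
      total    : 𝔼 weighted (λ _ → 1#) ≈ 1#

  return : {X : Set} → X → Weighted X
  return x = (1# , x) ∷ []

  infixl 1 _>>=_
  _>>=_ : {X Y : Set} → Weighted X → (X → Weighted Y) → Weighted Y
  D >>= f = concatMap (λ (w , x) → List.map (λ (v , y) → w *ᴿ v , y) (f x)) D

  -- t independent bits, each of them true with probability p.
  bernoulli : Carrier → ∀ t → Weighted (Vec Bool t)
  bernoulli p zero    = return []
  bernoulli p (suc t) =
    ((p , true) ∷ (1# -ᴿ p , false) ∷ []) >>= λ b →
    bernoulli p t >>= λ bs →
    return (b ∷ bs)

  indicator : Bool → Carrier
  indicator b = if b then 1# else 0#

  ----------------------------------------------------------------------
  -- Distinguishing problems

  -- YesCase indexes the possible Yes cases.  Each is a distribution on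
  -- instances, all of them of the same size yesSize.
  record Problem ℓ : Set (c ⊔ lsuc ℓ) where
    field
      Instance : Set
      size     : Instance → ℕ
      encode   : Instance → List Bool
      YesCase  : Set ℓ
      yesSize  : YesCase → ℕ
      yes      : YesCase → Weighted Instance
      NoCase   : Instance → Set ℓ

  module _ {ℓ} (P : Problem ℓ) where
    open Problem P

    timeBound : ℕ → Instance → ℕ
    timeBound d I = size I ^ d + d

    -- On every instance, A halts within size ^ d + d steps.
    RunsInTime : Algorithm → ℕ → Set
    RunsInTime A d = ∀ I → HaltsWithin A (timeBound d I) (encode I)

    PolynomialTime : Set
    PolynomialTime = Σ[ A ∈ Algorithm ] ∃[ d ] RunsInTime A d

    Pr-accept : PolynomialTime → Instance → Carrier
    Pr-accept (A , d , _) I =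
      𝔼 (bernoulli ½ (timeBound d I)) λ coins → indicator (accepts A (encode I) coins)

    AdvantageAtLeast : Carrier → PolynomialTime → ℕ → Set (ℓ ⊔ ℓ₃)
    AdvantageAtLeast η A s =
      ∀ (Y : YesCase) (J : Instance) → NoCase J → yesSize Y ≡ s → size J ≡ s →
      η ≤ᴿ 𝔼 (yes Y) (Pr-accept A) -ᴿ Pr-accept A J

    -- No polynomial-time algorithm distinguishes the Yes case from the No case
    -- with advantage more than o(1).
    Indistinguishable : Reading → Set (c ⊔ ℓ ⊔ ℓ₃)
    Indistinguishable almostAllSizes =
      ∀ A η → 0# <ᴿ η → ¬ (∃[ N ] ∀ s → s ≥ N → AdvantageAtLeast η A s)
    Indistinguishable infinitelyManySizes =
      ∀ A η → 0# <ᴿ η → ∃[ N ] ∀ s → s ≥ N → ¬ AdvantageAtLeast η A s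

  AtMostSatisfiable : ∀ {n m k} → Carrier → ((Fin n → Fin k) → Subset m) → Set ℓ₃
  AtMostSatisfiable {m = m} δ satisfied = ∀ x → fromℕ ∣ satisfied x ∣ ≤ᴿ δ *ᴿ fromℕ m

  ----------------------------------------------------------------------
  -- The 2-to-2 conjecture

  TwoToTwoProblem : ℕ → Carrier → Problem ℓ₃
  TwoToTwoProblem k δ = record
    { Instance = TwoToTwoGame k
    ; size     = size
    ; encode   = encode22
    ; YesCase  = Level.Lift ℓ₃ (Σ[ I ∈ TwoToTwoGame k ] CompletelySatisfiable (satisfied I))
    ; yesSize  = λ Y → size (proj₁ (Level.lower Y))
    ; yes      = λ Y → return (proj₁ (Level.lower Y))
    ; NoCase   = λ I → AtMostSatisfiable δ (satisfied I)
    }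
    where
    open TwoToTwoGame
    size : TwoToTwoGame k → ℕ
    size I = n I + m I + k

  TwoToTwoConjecture : Reading → Set (c ⊔ ℓ₃)
  TwoToTwoConjecture r =
    ∀ δ → 0# <ᴿ δ → ∃[ k₀ ] ∀ k → k ≥ k₀ → 2 ∣ k → Indistinguishable (TwoToTwoProblem k δ) r

  ----------------------------------------------------------------------
  -- Random edges, adversarial constraints

  -- The adversary may randomize her reply to the random set E_ε.
  record Adversary : Set (c ⊔ ℓ₁ ⊔ ℓ₃) where
    field
      original    : UniqueGame
    open UniqueGame original public
    field
      satisfiable : CompletelySatisfiable satisfied
      reply       : Subset m → Distribution (Fin m → Permutation′ k)

    -- Only the constraints of the edges in E_ε are replaced.
    corrupt : Subset m → (Fin m → Permutation′ k) → UniqueGame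
    corrupt Eε π′ = record
      { graph = graph
      ; π     = λ e → if lookup Eε e then π′ e else π e
      }

  semiRandom : Carrier → Adversary → Weighted UniqueGame
  semiRandom ε 𝒜 =
    bernoulli ε m >>= λ Eε →
    Distribution.weighted (reply Eε) >>= λ π′ →
    return (corrupt Eε π′)
    where open Adversary 𝒜

  SemiRandomUG : Carrier → Carrier → Problem (c ⊔ ℓ₁ ⊔ ℓ₃)
  SemiRandomUG ε δ = record
    { Instance = UniqueGame
    ; size     = size
    ; encode   = encodeUG
    ; YesCase  = Adversary
    ; yesSize  = λ 𝒜 → size (Adversary.original 𝒜)
    ; yes      = semiRandom ε
    ; NoCase   = λ I → Level.Lift (c ⊔ ℓ₁ ⊔ ℓ₃) (AtMostSatisfiable δ (UniqueGame.satisfied I))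
    }
    where
    open UniqueGame
    size : UniqueGame → ℕ
    size I = n I + m I + k I

{-# OPTIONS --safe #-}

-- A 2-to-2 constraint is a 2-regular bipartite graph, hence the union of two
-- perfect matchings.  Keep one of the two, chosen by a fair coin, on every edge.
-- If the 2-to-2 game is satisfiable, then on each edge independently a correct
-- matching is exchanged for the other one with probability 1/2, which is the
-- distribution produced by an adversary who exchanges the matching of each edge
-- of E_ε with probability 1/(2ε).  If the 2-to-2 game is at most δ satisfiable,
-- so is every unique game obtained.  The reduction preserves n, m and k, so an
-- advantage at size s is inherited at size s.  A single value of k suffices, and
-- then the matchings can be tabulated in a decision tree inside the program.

module Submission where

open import Defs
open import Level using (_⊔_; lift)
open import Algebra.Apartness.Bundles using (HeytingField; HeytingCommutativeRing)
open import Algebra.Bundles using (CommutativeRing)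
open import Data.Bool.Base using (Bool; true; false; not; _∧_; _xor_; if_then_else_)
import Data.Bool.Properties as Bool
open import Data.Fin.Base using (Fin; zero; suc; toℕ; punchOut)
open import Data.Fin.Permutation as Permutation using (Permutation′; permutation; _⟨$⟩ʳ_)
import Data.Fin.Properties as Fin
open import Data.Fin.Subset using (∣_∣; ⊤)
import Data.Fin.Subset.Properties as Subset
open import Data.List.Base as List using (List; []; _∷_; _++_; _ʳ++_; concatMap; allFin; length)
import Data.List.Properties as List
open import Data.List.Relation.Unary.All as All using (All; []; _∷_)
import Data.List.Relation.Unary.All.Properties as All
open import Data.Nat.Base using (ℕ; zero; suc; _+_; _*_; _∸_; _^_; _≤_; z≤n; s≤s; NonZero)
open import Data.Nat.Divisibility using (m∣m*n)
import Data.Nat.Properties as ℕ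
open import Data.Nat.Tactic.RingSolver using (solve-∀)
open import Data.Product.Base using (Σ-syntax; ∃; ∃-syntax; _×_; _,_; proj₁; proj₂; uncurry′)
open import Data.Sum.Base using (_⊎_; inj₁; inj₂; [_,_]′)
open import Data.Vec.Base as Vec using (Vec; []; _∷_; lookup; tabulate; zipWith; _[_]%=_)
import Data.Vec.Properties as Vec
open import Function.Base using (_∘_; id; const; case_of_)
open import Function.Definitions using (Injective)
open import Relation.Binary.Definitions using (DecidableEquality)
open import Relation.Binary.PropositionalEquality using (_≡_; _≢_; refl; sym; trans; cong; cong₂; subst)
open import Relation.Nullary using (¬_; Dec; yes; no; contradiction; does)
open import Relation.Nullary.Decidable using (_×-dec_; dec-true)

-- Splitting a 2-regular bipartite graph into perfect matchings

-- The program cannot tell which matching of an edge agrees with a satisfying assignment; the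
-- adversary, being unbounded, starts from the agreeing ones. The two distributions coincide because
-- a fair bit xored with a fixed bit is fair, so a choice by fair coins carries no trace of the
-- correct one. An edge is exchanged with probability ε times the rate at which the adversary
-- exchanges inside E_ε. For the product to be 1/2 the rate must be 1/(2ε), and this is at most 1
-- exactly when ε ≥ 1/2. In the No case nothing has to be matched: every outcome of the coins is a
-- No instance, so a bound on the acceptance probability that holds for each outcome holds for the
-- average. All comparisons are exact, hence η and the threshold on sizes carry over unchanged. The
-- order of the field is not assumed decidable, so sign arguments go through cotransitivity and
-- apartness instead of case distinctions.

AtMostTwoToOne : {A B : Set} → (A → B) → Set
AtMostTwoToOne h = ∀ x y z → h x ≡ h y → h y ≡ h z → x ≡ y ⊎ y ≡ z ⊎ x ≡ z

-- A single function `s` encodes both parts: `s i` is the edge of left vertex `i` that goes to part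
-- `false`, and the other one goes to part `true`.
choose : ∀ {n} {X : Set} → (Fin n → Bool → X) → (Fin n → Bool) → Bool → Fin n → X
choose h s b i = h i (b xor s i)

module _ {X : Set} (_≟_ : DecidableEquality X) where

  merge : X → X → X → X
  merge a b x with x ≟ b
  ... | yes _ = a
  ... | no  _ = x

  -- Delete the first left vertex and merge its two neighbours: in a splitting
  -- of the rest, the two neighbours' remaining edges lie in different parts, so
  -- the edges of the deleted vertex can be distributed accordingly.
  split : ∀ n (h : Fin n → Bool → X) → AtMostTwoToOne (uncurry′ h) →
          ∃[ s ] ∀ b → Injective _≡_ _≡_ (choose h s b)
  split zero    h h₂ = (λ ()) , λ { b {()} }
  split (suc n) h h₂ with split n (λ i b → merge (h zero false) (h zero true) (h (suc i) b)) merged₂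
    where
    -- Besides the edge from the deleted vertex, each of its neighbours keeps at most one edge. The
    -- merged vertex collects those of both neighbours and is therefore hit at most twice.
    lone : ∀ x₀ x y → h zero x₀ ≡ h (suc (proj₁ x)) (proj₂ x) → h zero x₀ ≡ h (suc (proj₁ y)) (proj₂ y) → x ≡ y
    lone x₀ x y p q with h₂ (zero , x₀) (suc (proj₁ x) , proj₂ x) (suc (proj₁ y) , proj₂ y) p (trans (sym p) q)
    ... | inj₂ (inj₁ refl) = refl
    merged₂ : AtMostTwoToOne (uncurry′ λ i b → merge (h zero false) (h zero true) (h (suc i) b))
    merged₂ x y z p q
      with h (suc (proj₁ x)) (proj₂ x) ≟ h zero true
         | h (suc (proj₁ y)) (proj₂ y) ≟ h zero true
         | h (suc (proj₁ z)) (proj₂ z) ≟ h zero true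
    ... | yes x₁ | yes y₁ | _      = inj₁ (lone true x y (sym x₁) (sym y₁))
    ... | yes x₁ | no _   | yes z₁ = inj₂ (inj₂ (lone true x z (sym x₁) (sym z₁)))
    ... | yes _  | no _   | no _   = inj₂ (inj₁ (lone false y z p (trans p q)))
    ... | no _   | yes y₁ | yes z₁ = inj₂ (inj₁ (lone true y z (sym y₁) (sym z₁)))
    ... | no _   | yes _  | no _   = inj₂ (inj₂ (lone false x z (sym p) q))
    ... | no _   | no _   | yes _  = inj₁ (lone false x y (sym (trans p q)) (sym q))
    ... | no _   | no _   | no _   with h₂ (suc (proj₁ x) , proj₂ x) (suc (proj₁ y) , proj₂ y) (suc (proj₁ z) , proj₂ z) p q
    ...   | inj₁ refl        = inj₁ refl
    ...   | inj₂ (inj₁ refl) = inj₂ (inj₁ refl)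
    ...   | inj₂ (inj₂ refl) = inj₂ (inj₂ refl)
  ... | s , injective = extend
    where
    rest : Bool → Fin n → X
    rest = choose (h ∘ suc) s

    merge-false : merge (h zero false) (h zero true) (h zero false) ≡ h zero false
    merge-false with h zero false ≟ h zero true
    ... | yes _ = refl
    ... | no  _ = refl

    merge-true : merge (h zero false) (h zero true) (h zero true) ≡ h zero false
    merge-true with h zero true ≟ h zero true
    ... | yes _ = refl
    ... | no ¬p = contradiction refl ¬p

    merge-either : ∀ x₀ → merge (h zero false) (h zero true) (h zero x₀) ≡ h zero false
    merge-either false = merge-false
    merge-either true  = merge-true

    xor-cancel : ∀ b t → b xor t ≢ not b xor t
    xor-cancel false false ()
    xor-cancel false true  ()
    xor-cancel true  false ()
    xor-cancel true  true  ()

    -- This is what merging is for: remaining edges of equal colour at the two neighbours would end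
    -- in the merged vertex, so by injectivity they start at one vertex `i`. Then they are the same
    -- edge and the two neighbours are equal, which gives three edges at one right vertex.
    sameColour : ∀ b x₀ i → h zero x₀ ≡ rest b i → ∀ j → h zero (not x₀) ≢ rest b j
    sameColour b x₀ i p j q
      with refl ← injective b (trans (cong (merge _ _) (sym p)) (trans (merge-either x₀)
                    (trans (sym (merge-either (not x₀))) (cong (merge _ _) q))))
      with h₂ (zero , x₀) (zero , not x₀) (suc i , b xor s i) (trans p (sym q)) q
    ... | inj₁ e = Bool.not-¬ refl (cong proj₂ e)
    ... | inj₂ (inj₁ ())
    ... | inj₂ (inj₂ ())

    -- Edges of both colours at this neighbour, together with the one from the deleted vertex, would
    -- be three.
    otherColour : ∀ b x₀ i → h zero x₀ ≡ rest b i → ∀ j → h zero x₀ ≢ rest (not b) j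
    otherColour b x₀ i p j q
      with h₂ (zero , x₀) (suc i , b xor s i) (suc j , not b xor s j) p (trans (sym p) q)
    ... | inj₂ (inj₁ e) with refl ← Fin.suc-injective (cong proj₁ e) = xor-cancel b (s i) (cong proj₂ e)

    cons : (s₀ : Bool) → (∀ b i → h zero (b xor s₀) ≢ rest b i) →
           ∃[ s′ ] ∀ b → Injective _≡_ _≡_ (choose h s′ b)
    cons s₀ fresh = s′ , inj
      where
      s′ : Fin (suc n) → Bool
      s′ zero    = s₀
      s′ (suc i) = s i
      inj : ∀ b → Injective _≡_ _≡_ (choose h s′ b)
      inj b {zero}  {zero}  e = refl
      inj b {zero}  {suc j} e = contradiction e (fresh b j)
      inj b {suc i} {zero}  e = contradiction (sym e) (fresh b i)
      inj b {suc i} {suc j} e = cong suc (injective b (cong (merge _ _) e))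

    extend : ∃[ s′ ] ∀ b → Injective _≡_ _≡_ (choose h s′ b)
    -- By default edge `b` of the new vertex joins part `b`. This fails only if, for some `b`, the
    -- neighbour along edge `b` is already met by part `b`; then the exchanged assignment
    -- `s₀ = true` is free of conflicts.
    extend with Fin.any? (λ i → h zero false ≟ rest false i) | Fin.any? (λ i → h zero true ≟ rest true i)
    ... | yes (i , p) | _           = cons true λ where
      false → sameColour false false i p
      true  → otherColour false false i p
    ... | no _        | yes (i , p) = cons true λ where
      false → otherColour true true i p
      true  → sameColour true true i p
    ... | no ¬p       | no ¬q       = cons false λ where
      false i e → ¬p (i , e)
      true  i e → ¬q (i , e)

-- Two-regular predicates as unions of two permutations

injective⇒permutation : ∀ {k} (f : Fin k → Fin k) → Injective _≡_ _≡_ f →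
                        Σ[ σ ∈ Permutation′ k ] ∀ i → σ ⟨$⟩ʳ i ≡ f i
injective⇒permutation {k} f inj =
  permutation f (proj₁ ∘ preimage inj) (proj₂ ∘ preimage inj) (λ i → inj (proj₂ (preimage inj (f i)))) , λ _ → refl
  where
  preimage : ∀ {k} {f : Fin k → Fin k} → Injective _≡_ _≡_ f → ∀ j → ∃[ i ] f i ≡ j
  preimage {suc k} {f} inj j with Fin.any? (λ i → f i Fin.≟ j)
  ... | yes p = p
  -- If `j` were missed, removing it from the codomain would inject `Fin (suc k)` into `Fin k`.
  ... | no ¬p = contradiction
    (Fin.injective⇒≤ {f = λ i → punchOut (λ j≡fi → ¬p (i , sym j≡fi))} (inj ∘ Fin.punchOut-injective {i = j} _ _))
    ℕ.1+n≰n

TwoRegular : ∀ {k} → (Fin k → Fin k → Bool) → Set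
TwoRegular f = (∀ i → ∣ tabulate (f i) ∣ ≡ 2) × (∀ j → ∣ tabulate (λ i → f i j) ∣ ≡ 2)

twoRegular? : ∀ {k} (f : Fin k → Fin k → Bool) → Dec (TwoRegular f)
twoRegular? f = Fin.all? (λ i → _ ℕ.≟ _) ×-dec Fin.all? (λ j → _ ℕ.≟ _)

-- The first half keeps No instances No instances; the second provides, on each edge satisfied in
-- the 2-to-2 game, a matching that is satisfied too.
IsUnionOf : ∀ {k} → (Fin k → Fin k → Bool) → (Bool → Permutation′ k) → Set
IsUnionOf f σ = (∀ b i → f i (σ b ⟨$⟩ʳ i) ≡ true) × (∀ i j → f i j ≡ true → ∃[ b ] j ≡ σ b ⟨$⟩ʳ i)

count≡0⇒none : ∀ {n} (g : Fin n → Bool) → ∣ tabulate g ∣ ≡ 0 → ∀ i → g i ≢ true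
count≡0⇒none {suc n} g p i with g zero in eq
count≡0⇒none {suc n} g p zero    | false = λ q → case trans (sym eq) q of λ ()
count≡0⇒none {suc n} g p (suc i) | false = count≡0⇒none (g ∘ suc) p i

count≡1⇒unique : ∀ {n} (g : Fin n → Bool) → ∣ tabulate g ∣ ≡ 1 →
      ∃[ a ] g a ≡ true × (∀ i → g i ≡ true → i ≡ a)
count≡1⇒unique {suc n} g p with g zero in eq
... | true = zero , eq , λ where
  zero    _ → refl
  (suc i) q → contradiction q (count≡0⇒none (g ∘ suc) (ℕ.suc-injective p) i)
... | false with a , ga , unique ← count≡1⇒unique (g ∘ suc) p = suc a , ga , λ where
  zero    q → case trans (sym eq) q of λ ()
  (suc i) q → cong suc (unique i q)

count≡2⇒pair : ∀ {n} (g : Fin n → Bool) → ∣ tabulate g ∣ ≡ 2 →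
      Σ[ a ∈ (Bool → Fin n) ] a false ≢ a true × (∀ b → g (a b) ≡ true) × (∀ i → g i ≡ true → ∃[ b ] i ≡ a b)
count≡2⇒pair {suc n} g p with g zero in eq
... | true with a , ga , unique ← count≡1⇒unique (g ∘ suc) (ℕ.suc-injective p) =
  (λ b → if b then suc a else zero) , (λ ()) , (λ { false → eq ; true → ga }) , λ where
    zero    _ → false , refl
    (suc i) q → true , cong suc (unique i q)
... | false with a , a≢ , ga , only ← count≡2⇒pair (g ∘ suc) p =
  suc ∘ a , a≢ ∘ Fin.suc-injective , ga , λ where
    zero    q → case trans (sym eq) q of λ ()
    (suc i) q → let b , r = only i q in b , cong suc r

pigeonhole : ∀ {A : Set} (a : Bool → A) {x y z} →
  ∃[ b ] x ≡ a b → ∃[ b ] y ≡ a b → ∃[ b ] z ≡ a b → x ≡ y ⊎ y ≡ z ⊎ x ≡ z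
pigeonhole a (false , p) (false , q) _           = inj₁ (trans p (sym q))
pigeonhole a (true  , p) (true  , q) _           = inj₁ (trans p (sym q))
pigeonhole a (false , p) (true  , q) (false , r) = inj₂ (inj₂ (trans p (sym r)))
pigeonhole a (false , p) (true  , q) (true  , r) = inj₂ (inj₁ (trans q (sym r)))
pigeonhole a (true  , p) (false , q) (true  , r) = inj₂ (inj₂ (trans p (sym r)))
pigeonhole a (true  , p) (false , q) (false , r) = inj₂ (inj₁ (trans q (sym r)))

-- König's theorem for 2-regular bipartite graphs.
decompose : ∀ {k} {f : Fin k → Fin k → Bool} → TwoRegular f → ∃ (IsUnionOf f)
decompose {k} {f} (rows , columns) = proj₁ ∘ perm , sound , complete
  where
  neighbour : Fin k → Bool → Fin k
  neighbour i = proj₁ (count≡2⇒pair (f i) (rows i))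

  edge : ∀ i b → f i (neighbour i b) ≡ true
  edge i = proj₁ (proj₂ (proj₂ (count≡2⇒pair (f i) (rows i))))

  distinct : ∀ i {b c} → neighbour i b ≡ neighbour i c → b ≡ c
  distinct i {false} {false} _ = refl
  distinct i {false} {true}  p = contradiction p (proj₁ (proj₂ (count≡2⇒pair (f i) (rows i))))
  distinct i {true}  {false} p = contradiction (sym p) (proj₁ (proj₂ (count≡2⇒pair (f i) (rows i))))
  distinct i {true}  {true}  _ = refl

  sameRow : ∀ {i j b c} → i ≡ j → neighbour i b ≡ neighbour j c → (i , b) ≡ (j , c)
  sameRow {i} refl p = cong (i ,_) (distinct i p)

  neighbour₂ : AtMostTwoToOne (uncurry′ neighbour)
  neighbour₂ (i₁ , b₁) (i₂ , b₂) (i₃ , b₃) p q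
    -- The column of the common right vertex has two entries, so two of the three rows coincide;
    -- within a row the two neighbours are distinct, so the edges coincide as well.
    with a , _ , _ , only ← count≡2⇒pair (λ i → f i (neighbour i₁ b₁)) (columns _)
    with pigeonhole a (only i₁ (edge i₁ b₁))
           (only i₂ (trans (cong (f i₂) p) (edge i₂ b₂)))
           (only i₃ (trans (cong (f i₃) (trans p q)) (edge i₃ b₃)))
  ... | inj₁ e        = inj₁ (sameRow e p)
  ... | inj₂ (inj₁ e) = inj₂ (inj₁ (sameRow e q))
  ... | inj₂ (inj₂ e) = inj₂ (inj₂ (sameRow e (trans p q)))

  s : Fin k → Bool
  s = proj₁ (split Fin._≟_ k neighbour neighbour₂)

  perm : (b : Bool) → Σ[ σ ∈ Permutation′ k ] ∀ i → σ ⟨$⟩ʳ i ≡ choose neighbour s b i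
  perm b = injective⇒permutation (choose neighbour s b) (proj₂ (split Fin._≟_ k neighbour neighbour₂) b)

  sound : ∀ b i → f i (proj₁ (perm b) ⟨$⟩ʳ i) ≡ true
  sound b i = trans (cong (f i) (proj₂ (perm b) i)) (edge i (b xor s i))

  xor-involutive : ∀ b t → b ≡ (b xor t) xor t
  xor-involutive false false = refl
  xor-involutive false true  = refl
  xor-involutive true  false = refl
  xor-involutive true  true  = refl

  complete : ∀ i j → f i j ≡ true → ∃[ b ] j ≡ proj₁ (perm b) ⟨$⟩ʳ i
  complete i j p with b , q ← proj₂ (proj₂ (proj₂ (count≡2⇒pair (f i) (rows i)))) j p =
    b xor s i , trans q (trans (cong (neighbour i) (xor-involutive b (s i))) (sym (proj₂ (perm (b xor s i)) i)))

-- Ordered fields and expectations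

module OrderedField {c ℓ₁ ℓ₂ ℓ₃} (ℝ : ArchimedeanOrderedField c ℓ₁ ℓ₂ ℓ₃) where
  open ArchimedeanOrderedField ℝ public hiding (zero) renaming (refl to ≈-refl; sym to ≈-sym; trans to ≈-trans)
  open CommutativeRing (HeytingCommutativeRing.commutativeRing (HeytingField.heytingCommutativeRing heytingField)) public
    using (-_; ring; commutativeSemiring)
  open import Algebra.Properties.Ring ring public using (-0#≈0#)
  open import Algebra.Solver.Ring.NaturalCoefficients.Default commutativeSemiring
    using (solve; _:=_; _:+_; _:*_; con)
  open import Relation.Binary.Reasoning.Setoid setoid

  <-resp : ∀ {x x′ y y′} → x ≈ x′ → y ≈ y′ → x <ᴿ y → x′ <ᴿ y′
  <-resp p q = <-respˡ-≈ p ∘ <-respʳ-≈ q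

  ≤-resp : ∀ {x x′ y y′} → x ≈ x′ → y ≈ y′ → x ≤ᴿ y → x′ ≤ᴿ y′
  ≤-resp p q x≤y y′<x′ = x≤y (<-resp (≈-sym q) (≈-sym p) y′<x′)

  <-irreflexive : ∀ {x} → ¬ x <ᴿ x
  <-irreflexive = <-irrefl ≈-refl

  -- Inherited from apartness, this stands in for trichotomy: the mixed transitivity laws and
  -- `+-mono-≤` are case distinctions on it.
  <-cotrans : ∀ {x y} → x <ᴿ y → ∀ z → (x <ᴿ z) ⊎ (z <ᴿ y)
  <-cotrans {x} {y} x<y z with #-cotrans (<⇒# x<y) z
  ... | inj₁ x#z = [ inj₁ , (λ z<x → inj₂ (<-trans z<x x<y)) ]′ (#⇒<⊎> x#z)
  ... | inj₂ z#y = [ inj₂ , (λ y<z → inj₁ (<-trans x<y y<z)) ]′ (#⇒<⊎> z#y)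

  <-≤-trans : ∀ {x y z} → x <ᴿ y → y ≤ᴿ z → x <ᴿ z
  <-≤-trans {z = z} x<y y≤z with <-cotrans x<y z
  ... | inj₁ x<z = x<z
  ... | inj₂ z<y = contradiction z<y y≤z

  ≤-trans : ∀ {x y z} → x ≤ᴿ y → y ≤ᴿ z → x ≤ᴿ z
  ≤-trans x≤y y≤z z<x = x≤y (≤-<-trans y≤z z<x)
    where
    ≤-<-trans : ∀ {x y z} → x ≤ᴿ y → y <ᴿ z → x <ᴿ z
    ≤-<-trans {x} x≤y y<z with <-cotrans y<z x
    ... | inj₁ y<x = contradiction y<x x≤y
    ... | inj₂ x<z = x<z

  +-monoʳ-< : ∀ {x y} z → x <ᴿ y → z +ᴿ x <ᴿ z +ᴿ y
  +-monoʳ-< z = <-resp (+-comm _ z) (+-comm _ z) ∘ +-monoˡ-< z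

  private
    cancel : ∀ x z → (x +ᴿ z) -ᴿ z ≈ x
    cancel x z = ≈-trans (+-assoc x z (- z)) (≈-trans (+-cong ≈-refl (-‿inverseʳ z)) (+-identityʳ x))

    uncancel : ∀ x z → (x -ᴿ z) +ᴿ z ≈ x
    uncancel x z = ≈-trans (+-assoc x (- z) z) (≈-trans (+-cong ≈-refl (-‿inverseˡ z)) (+-identityʳ x))

  +-cancelʳ-< : ∀ {x y} z → x +ᴿ z <ᴿ y +ᴿ z → x <ᴿ y
  +-cancelʳ-< z = <-resp (cancel _ z) (cancel _ z) ∘ +-monoˡ-< (- z)

  +-cancelˡ-< : ∀ {x y} z → z +ᴿ x <ᴿ z +ᴿ y → x <ᴿ y
  +-cancelˡ-< z = +-cancelʳ-< z ∘ <-resp (+-comm z _) (+-comm z _)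

  +-mono-≤ : ∀ {x x′ y y′} → x ≤ᴿ x′ → y ≤ᴿ y′ → x +ᴿ y ≤ᴿ x′ +ᴿ y′
  +-mono-≤ {x} {x′} {y} {y′} x≤x′ y≤y′ lt with <-cotrans lt (x +ᴿ y′)
  ... | inj₁ p = x≤x′ (+-cancelʳ-< y′ p)
  ... | inj₂ p = y≤y′ (+-cancelˡ-< x p)

  *-monoʳ-< : ∀ {x y z} → 0# <ᴿ z → x <ᴿ y → z *ᴿ x <ᴿ z *ᴿ y
  *-monoʳ-< {x} {y} {z} 0<z x<y = <-resp (+-identityˡ _) eq (+-monoˡ-< (z *ᴿ x) (*-pos 0<z 0<y-x))
    where
    0<y-x : 0# <ᴿ y -ᴿ x
    0<y-x = <-respˡ-≈ (-‿inverseʳ x) (+-monoˡ-< (- x) x<y)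
    eq : z *ᴿ (y -ᴿ x) +ᴿ z *ᴿ x ≈ z *ᴿ y
    eq = ≈-trans (≈-sym (distribˡ z (y -ᴿ x) x)) (*-cong ≈-refl (uncancel y x))

  x+1-x≈1 : ∀ x → x +ᴿ (1# -ᴿ x) ≈ 1#
  x+1-x≈1 x = ≈-trans (+-comm _ _) (uncancel 1# x)

  private
    0<2 : 0# <ᴿ 1# +ᴿ 1#
    0<2 = <-trans 0<1 (<-respˡ-≈ (+-identityˡ 1#) (+-monoˡ-< 1# 0<1))

  ½+½≈1 : ½ +ᴿ ½ ≈ 1#
  ½+½≈1 = begin
    ½ +ᴿ ½                     ≈⟨ solve 1 (λ h → h :+ h := h :* (con 1 :+ con 1)) ≈-refl ½ ⟩
    -- Invertibility is stated for the difference of two apart elements, so `½` is by definition the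
    -- inverse of 2 - 0.
    ½ *ᴿ (1# +ᴿ 1#)            ≈⟨ *-cong ≈-refl (≈-sym (≈-trans (+-cong ≈-refl -0#≈0#) (+-identityʳ _))) ⟩
    ½ *ᴿ ((1# +ᴿ 1#) -ᴿ 0#)    ≈⟨ proj₁ (proj₂ (#⇒invertible (#-sym (<⇒# 0<2)))) ⟩
    1#                         ∎

  1-½≈½ : 1# -ᴿ ½ ≈ ½
  1-½≈½ = ≈-trans (+-cong (≈-sym ½+½≈1) ≈-refl) (cancel ½ ½)

  0<½ : 0# <ᴿ ½
  0<½ with <-cotrans (<-respʳ-≈ (≈-sym ½+½≈1) 0<1) ½
  ... | inj₁ 0<½ = 0<½
  ... | inj₂ ½<½+½ = +-cancelʳ-< ½ (<-respˡ-≈ (≈-sym (+-identityˡ ½)) ½<½+½)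

  ½x+½x≈x : ∀ x → ½ *ᴿ x +ᴿ ½ *ᴿ x ≈ x
  ½x+½x≈x x = ≈-trans (≈-sym (distribʳ x ½ ½)) (≈-trans (*-cong ½+½≈1 ≈-refl) (*-identityˡ x))

  -- The second weight is left as `1# -ᴿ ½` so that `𝔼-bernoulli-suc` at `½` has literally this
  -- form.
  average : Carrier → Carrier → Carrier
  average x y = ½ *ᴿ x +ᴿ (1# -ᴿ ½) *ᴿ y

  average-cong : ∀ {x x′ y y′} → x ≈ x′ → y ≈ y′ → average x y ≈ average x′ y′
  average-cong p q = +-cong (*-cong ≈-refl p) (*-cong ≈-refl q)

  average-same : ∀ x → average x x ≈ x
  average-same x = ≈-trans (+-cong ≈-refl (*-cong 1-½≈½ ≈-refl)) (½x+½x≈x x)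

  *-½-mono-≤ : ∀ {x y} → x ≤ᴿ y → ½ *ᴿ x ≤ᴿ ½ *ᴿ y
  *-½-mono-≤ {x} {y} x≤y lt =
    x≤y (<-resp (½x+½x≈x y) (½x+½x≈x x) (<-trans (+-monoˡ-< (½ *ᴿ y) lt) (+-monoʳ-< (½ *ᴿ x) lt)))

  average-≤ : ∀ {x y z} → x ≤ᴿ z → y ≤ᴿ z → average x y ≤ᴿ z
  average-≤ {z = z} x≤z y≤z =
    ≤-resp (+-cong ≈-refl (*-cong (≈-sym 1-½≈½) ≈-refl)) (½x+½x≈x z) (+-mono-≤ (*-½-mono-≤ x≤z) (*-½-mono-≤ y≤z))

  -- Applied twice in the reduction: once to isolate the acceptance probability of the No instance,
  -- so that it can be averaged over coins, and once to put the average back.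
  ≤-minus⇒ : ∀ {x y z} → x ≤ᴿ y -ᴿ z → z ≤ᴿ y -ᴿ x
  ≤-minus⇒ {x} {y} {z} x≤y-z y-x<z = x≤y-z (+-cancelʳ-< z (<-resp eq (+-comm z x) (+-monoˡ-< x y-x<z)))
    where
    eq : (y -ᴿ x) +ᴿ x ≈ (y -ᴿ z) +ᴿ z
    eq = ≈-trans (uncancel y x) (≈-sym (uncancel y z))

  fromℕ-mono-≤ : ∀ {a b} → a ≤ b → fromℕ a ≤ᴿ fromℕ b
  fromℕ-mono-≤ {b = zero}  z≤n lt = <-irreflexive lt
  fromℕ-mono-≤ {b = suc b} z≤n lt =
    fromℕ-mono-≤ {b = b} z≤n (<-trans (<-respˡ-≈ (+-identityˡ _) (+-monoˡ-< (fromℕ b) 0<1)) lt)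
  fromℕ-mono-≤ (s≤s a≤b) lt = fromℕ-mono-≤ a≤b (+-cancelˡ-< 1# lt)

  ½≤⇒pos : ∀ {x} → ½ ≤ᴿ x → 0# <ᴿ x
  ½≤⇒pos = <-≤-trans 0<½

  pos⇒inverse : ∀ {x} → 0# <ᴿ x → ∃[ y ] x *ᴿ y ≈ 1#
  pos⇒inverse {x} 0<x = let y , _ , eq = #⇒invertible (#-sym (<⇒# 0<x)) in
    y , ≈-trans (*-cong (≈-sym (≈-trans (+-cong ≈-refl -0#≈0#) (+-identityʳ x))) ≈-refl) eq

  module _ {ε} (½≤ε : ½ ≤ᴿ ε) where

    1/2ε : Carrier
    1/2ε = ½ *ᴿ proj₁ (pos⇒inverse (½≤⇒pos ½≤ε))

    ε*1/2ε≈½ : ε *ᴿ 1/2ε ≈ ½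
    ε*1/2ε≈½ = begin
      ε *ᴿ (½ *ᴿ ε⁻¹) ≈⟨ solve 3 (λ e h i → e :* (h :* i) := h :* (e :* i)) ≈-refl ε ½ ε⁻¹ ⟩
      ½ *ᴿ (ε *ᴿ ε⁻¹) ≈⟨ *-cong ≈-refl (proj₂ (pos⇒inverse (½≤⇒pos ½≤ε))) ⟩
      ½ *ᴿ 1#         ≈⟨ *-identityʳ ½ ⟩
      ½               ∎
      where ε⁻¹ = proj₁ (pos⇒inverse (½≤⇒pos ½≤ε))

    0≤1/2ε : 0# ≤ᴿ 1/2ε
    0≤1/2ε 1/2ε<0 = <-irreflexive (<-trans 0<½ (<-resp ε*1/2ε≈½ (zeroʳ ε) (*-monoʳ-< (½≤⇒pos ½≤ε) 1/2ε<0)))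

    -- Here `½ ≤ ε` is used in full, beyond the positivity of `ε`: from 1 < 1/(2ε), multiplication
    -- by `ε` would give `ε < ½`.
    0≤1-1/2ε : 0# ≤ᴿ 1# -ᴿ 1/2ε
    0≤1-1/2ε 1-1/2ε<0 = ½≤ε (<-resp (*-identityʳ ε) ε*1/2ε≈½ (*-monoʳ-< (½≤⇒pos ½≤ε) 1<1/2ε))
      where
      1<1/2ε : 1# <ᴿ 1/2ε
      1<1/2ε = <-resp (uncancel 1# 1/2ε) (+-identityˡ 1/2ε) (+-monoˡ-< 1/2ε 1-1/2ε<0)

  -- Expectations and nonnegative weights

  private variable X Y : Set

  𝔼-cong : (D : Weighted ℝ X) {f g : X → Carrier} → (∀ x → f x ≈ g x) → 𝔼 ℝ D f ≈ 𝔼 ℝ D g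
  𝔼-cong []            f≈g = ≈-refl
  𝔼-cong ((w , x) ∷ D) f≈g = +-cong (*-cong ≈-refl (f≈g x)) (𝔼-cong D f≈g)

  𝔼-linear : (D : Weighted ℝ X) (u v : Carrier) (f g : X → Carrier) →
             𝔼 ℝ D (λ x → u *ᴿ f x +ᴿ v *ᴿ g x) ≈ u *ᴿ 𝔼 ℝ D f +ᴿ v *ᴿ 𝔼 ℝ D g
  𝔼-linear []            u v f g = ≈-sym (≈-trans (+-cong (zeroʳ u) (zeroʳ v)) (+-identityˡ 0#))
  𝔼-linear ((w , x) ∷ D) u v f g = ≈-trans (+-cong ≈-refl (𝔼-linear D u v f g))
    (solve 7 (λ w u v a b c d → w :* (u :* a :+ v :* b) :+ (u :* c :+ v :* d) := u :* (w :* a :+ c) :+ v :* (w :* b :+ d))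
      ≈-refl w u v (f x) (g x) (𝔼 ℝ D f) (𝔼 ℝ D g))

  𝔼-scale-++ : (w : Carrier) (D : Weighted ℝ X) (E : Weighted ℝ X) (f : X → Carrier) →
               𝔼 ℝ (List.map (λ (v , y) → w *ᴿ v , y) D ++ E) f ≈ w *ᴿ 𝔼 ℝ D f +ᴿ 𝔼 ℝ E f
  𝔼-scale-++ w []            E f = ≈-sym (≈-trans (+-cong (zeroʳ w) ≈-refl) (+-identityˡ _))
  𝔼-scale-++ w ((v , x) ∷ D) E f = ≈-trans (+-cong ≈-refl (𝔼-scale-++ w D E f))
    (solve 5 (λ w v a d e → w :* v :* a :+ (w :* d :+ e) := w :* (v :* a :+ d) :+ e) ≈-refl w v (f x) (𝔼 ℝ D f) (𝔼 ℝ E f))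

  𝔼->>= : (D : Weighted ℝ X) (F : X → Weighted ℝ Y) (f : Y → Carrier) →
          𝔼 ℝ (_>>=_ ℝ D F) f ≈ 𝔼 ℝ D (λ x → 𝔼 ℝ (F x) f)
  𝔼->>= []            F f = ≈-refl
  𝔼->>= ((w , x) ∷ D) F f = ≈-trans (𝔼-scale-++ w (F x) _ f) (+-cong ≈-refl (𝔼->>= D F f))

  𝔼-return : (x : X) (f : X → Carrier) → 𝔼 ℝ (return ℝ x) f ≈ f x
  𝔼-return x f = ≈-trans (+-identityʳ _) (*-identityˡ _)

  𝔼-map : (D : Weighted ℝ X) (F : X → Y) (f : Y → Carrier) →
          𝔼 ℝ (_>>=_ ℝ D (λ x → return ℝ (F x))) f ≈ 𝔼 ℝ D (f ∘ F)
  𝔼-map D F f = ≈-trans (𝔼->>= D (λ x → return ℝ (F x)) f) (𝔼-cong D λ x → 𝔼-return (F x) f)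

  𝔼-bernoulli-suc : ∀ p t (f : Vec Bool (suc t) → Carrier) →
    𝔼 ℝ (bernoulli ℝ p (suc t)) f ≈
    p *ᴿ 𝔼 ℝ (bernoulli ℝ p t) (f ∘ (true ∷_)) +ᴿ (1# -ᴿ p) *ᴿ 𝔼 ℝ (bernoulli ℝ p t) (f ∘ (false ∷_))
  𝔼-bernoulli-suc p t f = ≈-trans (𝔼->>= coin tail f)
    (+-cong (*-cong ≈-refl (𝔼-map (bernoulli ℝ p t) (true ∷_) f))
      (≈-trans (+-identityʳ _) (*-cong ≈-refl (𝔼-map (bernoulli ℝ p t) (false ∷_) f))))
    where
    coin : Weighted ℝ Bool
    coin = (p , true) ∷ (1# -ᴿ p , false) ∷ []
    tail : Bool → Weighted ℝ (Vec Bool (suc t))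
    tail b = _>>=_ ℝ (bernoulli ℝ p t) (λ bs → return ℝ (b ∷ bs))

  𝔼-bernoulli-const : ∀ p t x → 𝔼 ℝ (bernoulli ℝ p t) (λ _ → x) ≈ x
  𝔼-bernoulli-const p zero    x = ≈-trans (+-identityʳ _) (*-identityˡ x)
  𝔼-bernoulli-const p (suc t) x = ≈-trans (𝔼-bernoulli-suc p t (λ _ → x))
    (≈-trans (+-cong (*-cong ≈-refl (𝔼-bernoulli-const p t x)) (*-cong ≈-refl (𝔼-bernoulli-const p t x)))
      (≈-trans (≈-sym (distribʳ x p (1# -ᴿ p))) (≈-trans (*-cong (x+1-x≈1 p) ≈-refl) (*-identityˡ x))))

  𝔼-½-≤ : ∀ t {f : Vec Bool t → Carrier} {x} → (∀ bs → f bs ≤ᴿ x) → 𝔼 ℝ (bernoulli ℝ ½ t) f ≤ᴿ x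
  𝔼-½-≤ zero    {f} f≤x = ≤-resp (≈-sym (𝔼-return [] f)) ≈-refl (f≤x [])
  𝔼-½-≤ (suc t) {f} f≤x = ≤-resp (≈-sym (𝔼-bernoulli-suc ½ t f)) ≈-refl
    (average-≤ (𝔼-½-≤ t (f≤x ∘ (true ∷_))) (𝔼-½-≤ t (f≤x ∘ (false ∷_))))

  -- A negative product is apart from 0, hence invertible, and so both factors are apart from 0.
  -- Being nonnegative they are then positive, which makes the product positive.
  *-nonneg : ∀ {x y} → 0# ≤ᴿ x → 0# ≤ᴿ y → 0# ≤ᴿ x *ᴿ y
  *-nonneg {x} {y} 0≤x 0≤y xy<0 with #⇒invertible (<⇒# xy<0)
  ... | z , _ , xyz≈1 = <-irreflexive (<-trans (*-pos (positive 0≤x x#0) (positive 0≤y y#0)) xy<0)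
    where
    minus-0 : ∀ u → u -ᴿ 0# ≈ u
    minus-0 u = ≈-trans (+-cong ≈-refl -0#≈0#) (+-identityʳ u)

    xyz≈1′ : (x *ᴿ y) *ᴿ z ≈ 1#
    xyz≈1′ = ≈-trans (*-cong (≈-sym (minus-0 _)) ≈-refl) xyz≈1

    factor-#0 : ∀ u v → u *ᴿ v ≈ 1# → u # 0#
    factor-#0 u v uv≈1 = invertible⇒# (v , ≈-trans (*-comm v _) uv′ , uv′)
      where uv′ = ≈-trans (*-cong (minus-0 u) ≈-refl) uv≈1

    x#0 : x # 0#
    x#0 = factor-#0 x (y *ᴿ z) (≈-trans (≈-sym (*-assoc x y z)) xyz≈1′)

    y#0 : y # 0#
    y#0 = factor-#0 y (x *ᴿ z) (≈-trans (solve 3 (λ x y z → y :* (x :* z) := x :* y :* z) ≈-refl x y z) xyz≈1′)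

    positive : ∀ {u} → 0# ≤ᴿ u → u # 0# → 0# <ᴿ u
    positive 0≤u u#0 = [ (λ u<0 → contradiction u<0 0≤u) , (λ 0<u → 0<u) ]′ (#⇒<⊎> u#0)

  NonNegative : Weighted ℝ X → Set (c ⊔ ℓ₃)
  NonNegative = All (λ wx → 0# ≤ᴿ proj₁ wx)

  >>=-nonneg : {D : Weighted ℝ X} {F : X → Weighted ℝ Y} →
               NonNegative D → (∀ x → NonNegative (F x)) → NonNegative (_>>=_ ℝ D F)
  >>=-nonneg []                     F≥0 = []
  >>=-nonneg (_∷_ {x = w , x} w≥0 D≥0) F≥0 =
    All.++⁺ (All.map⁺ (All.map (*-nonneg w≥0) (F≥0 x))) (>>=-nonneg D≥0 F≥0)

  return-nonneg : (x : X) → NonNegative (return ℝ x)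
  return-nonneg x = <-asymmetric 0<1 ∷ []
    where
    <-asymmetric : ∀ {x y} → x <ᴿ y → ¬ y <ᴿ x
    <-asymmetric x<y y<x = <-irreflexive (<-trans x<y y<x)

  bernoulli-nonneg : ∀ {p} → 0# ≤ᴿ p → 0# ≤ᴿ 1# -ᴿ p → ∀ t → NonNegative (bernoulli ℝ p t)
  bernoulli-nonneg 0≤p 0≤1-p zero    = return-nonneg []
  bernoulli-nonneg 0≤p 0≤1-p (suc t) = >>=-nonneg (0≤p ∷ 0≤1-p ∷ []) λ b →
    >>=-nonneg (bernoulli-nonneg 0≤p 0≤1-p t) λ bs → return-nonneg (b ∷ bs)

  -- In the application `as` are the correct matchings, `es` is E_ε and `bs` are the adversary's own
  -- coins: an edge is exchanged if it lies in E_ε and its coin is true.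
  flips : ∀ {t} → Vec Bool t → Vec Bool t → Vec Bool t → Vec Bool t
  flips as es bs = zipWith _xor_ as (zipWith _∧_ es bs)

  -- The bits of es ∧ bs are independent, each true with probability εq.
  𝔼-flips : ∀ {ε q} → ε *ᴿ q ≈ ½ → ∀ {t} (as : Vec Bool t) (f : Vec Bool t → Carrier) →
    𝔼 ℝ (bernoulli ℝ ε t) (λ es → 𝔼 ℝ (bernoulli ℝ q t) (λ bs → f (flips as es bs))) ≈ 𝔼 ℝ (bernoulli ℝ ½ t) f
  𝔼-flips εq≈½ []       f = 𝔼-return [] (λ es → 𝔼 ℝ (return ℝ []) (λ bs → f (flips [] es bs)))
  𝔼-flips {ε} {q} εq≈½ {suc t} (a ∷ as) f = begin
    𝔼 ℝ (bernoulli ℝ ε (suc t)) (λ es → 𝔼 ℝ (bernoulli ℝ q (suc t)) (λ bs → f (flips (a ∷ as) es bs)))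
      ≈⟨ 𝔼-bernoulli-suc ε t _ ⟩
    ε *ᴿ 𝔼 ℝ (bernoulli ℝ ε t) (inner true) +ᴿ ε′ *ᴿ 𝔼 ℝ (bernoulli ℝ ε t) (inner false)
      ≈⟨ +-cong (*-cong ≈-refl (branch true)) (*-cong ≈-refl (branch false)) ⟩
    ε *ᴿ (q *ᴿ value (a xor true) +ᴿ q′ *ᴿ value (a xor false)) +ᴿ ε′ *ᴿ (q *ᴿ value (a xor false) +ᴿ q′ *ᴿ value (a xor false))
      ≈⟨ solve 6 (λ e e′ q q′ u v → e :* (q :* u :+ q′ :* v) :+ e′ :* (q :* v :+ q′ :* v) := e :* q :* u :+ (e :* q′ :+ e′ :* (q :+ q′)) :* v)
           ≈-refl ε ε′ q q′ (value (a xor true)) (value (a xor false)) ⟩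
    ε *ᴿ q *ᴿ value (a xor true) +ᴿ (ε *ᴿ q′ +ᴿ ε′ *ᴿ (q +ᴿ q′)) *ᴿ value (a xor false)
      ≈⟨ +-cong (*-cong εq≈½ ≈-refl) (*-cong rest≈½ ≈-refl) ⟩
    ½ *ᴿ value (a xor true) +ᴿ ½ *ᴿ value (a xor false)
      -- At this point the correct choice `a` disappears.
      ≈⟨ uniform a ⟩
    ½ *ᴿ value true +ᴿ ½ *ᴿ value false
      ≈⟨ +-cong ≈-refl (*-cong (≈-sym 1-½≈½) ≈-refl) ⟩
    average (value true) (value false)
      ≈⟨ 𝔼-bernoulli-suc ½ t f ⟨
    𝔼 ℝ (bernoulli ℝ ½ (suc t)) f ∎
    where
    ε′ q′ : Carrier
    ε′ = 1# -ᴿ ε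
    q′ = 1# -ᴿ q

    value : Bool → Carrier
    value b = 𝔼 ℝ (bernoulli ℝ ½ t) (f ∘ (b ∷_))

    inner : Bool → Vec Bool t → Carrier
    inner e es = 𝔼 ℝ (bernoulli ℝ q (suc t)) (λ bs → f (flips (a ∷ as) (e ∷ es) bs))

    branch : ∀ e → 𝔼 ℝ (bernoulli ℝ ε t) (inner e) ≈ q *ᴿ value (a xor (e ∧ true)) +ᴿ q′ *ᴿ value (a xor (e ∧ false))
    branch e = ≈-trans (𝔼-cong (bernoulli ℝ ε t) λ es → 𝔼-bernoulli-suc q t _)
      (≈-trans (𝔼-linear (bernoulli ℝ ε t) q q′ _ _)
        (+-cong (*-cong ≈-refl (𝔼-flips εq≈½ as _)) (*-cong ≈-refl (𝔼-flips εq≈½ as _))))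

    -- The weights of all four combinations add up to `(ε +ᴿ ε′) *ᴿ (q +ᴿ q′)`, which is 1, and the
    -- exchanging one takes `½` of it.
    rest≈½ : ε *ᴿ q′ +ᴿ ε′ *ᴿ (q +ᴿ q′) ≈ ½
    rest≈½ = begin
      ε *ᴿ q′ +ᴿ ε′ *ᴿ (q +ᴿ q′)               ≈⟨ cancel _ ½ ⟨
      (ε *ᴿ q′ +ᴿ ε′ *ᴿ (q +ᴿ q′)) +ᴿ ½ -ᴿ ½   ≈⟨ +-cong (+-cong ≈-refl (≈-sym εq≈½)) ≈-refl ⟩
      (ε *ᴿ q′ +ᴿ ε′ *ᴿ (q +ᴿ q′)) +ᴿ ε *ᴿ q -ᴿ ½
        ≈⟨ +-cong (solve 4 (λ e e′ q q′ → (e :* q′ :+ e′ :* (q :+ q′)) :+ e :* q := (e :+ e′) :* (q :+ q′)) ≈-refl ε ε′ q q′) ≈-refl ⟩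
      (ε +ᴿ ε′) *ᴿ (q +ᴿ q′) -ᴿ ½              ≈⟨ +-cong (*-cong (x+1-x≈1 ε) (x+1-x≈1 q)) ≈-refl ⟩
      1# *ᴿ 1# -ᴿ ½                            ≈⟨ +-cong (*-identityˡ 1#) ≈-refl ⟩
      1# -ᴿ ½                                  ≈⟨ 1-½≈½ ⟩
      ½                                        ∎

    uniform : ∀ a → ½ *ᴿ value (a xor true) +ᴿ ½ *ᴿ value (a xor false) ≈ ½ *ᴿ value true +ᴿ ½ *ᴿ value false
    uniform false = ≈-refl
    uniform true  = +-comm _ _

-- Programs rewriting every edge of an encoded game

-- Stack 0 is shared with the simulated program, whose other stacks are shifted
-- by two.  Stack 1 collects the output in reverse, stack 2 holds a loop flag.

relabel : ∀ {s} → Fin (suc s) → Fin (3 + s)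
relabel zero    = zero
relabel (suc i) = suc (suc (suc i))

embed : ∀ {s} → Program (suc s) → Program (3 + s)
embed skip          = skip
embed (push i c)    = push (relabel i) c
embed (pop i p q r) = pop (relabel i) (embed p) (embed q) (embed r)
embed (toss p q)    = toss (embed p) (embed q)
embed (p ⨾ q)       = embed p ⨾ embed q
embed (while i p)   = while (relabel i) (embed p)

insertEmpty : ∀ {s} → Vec (List Bool) (suc s) → Vec (List Bool) (3 + s)
insertEmpty (u ∷ σ) = u ∷ [] ∷ [] ∷ σ

embedState : ∀ {s} → State (suc s) → State (3 + s)
embedState (K , σ) = List.map embed K , insertEmpty σ

lookup-insertEmpty : ∀ {s} (σ : Vec (List Bool) (suc s)) i → lookup (insertEmpty σ) (relabel i) ≡ lookup σ i
lookup-insertEmpty (u ∷ σ) zero    = refl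
lookup-insertEmpty (u ∷ σ) (suc i) = refl

insertEmpty-%= : ∀ {s} (σ : Vec (List Bool) (suc s)) i f → insertEmpty σ [ relabel i ]%= f ≡ insertEmpty (σ [ i ]%= f)
insertEmpty-%= (u ∷ σ) zero    f = refl
insertEmpty-%= (u ∷ σ) (suc i) f = refl

step-embed : ∀ {s} b (S : State (suc s)) → step b (embedState S) ≡ embedState (step b S)
step-embed b ([]             , σ) = refl
step-embed b (skip ∷ K       , σ) = refl
step-embed b (push i c ∷ K   , σ) = cong (_ ,_) (insertEmpty-%= σ i (c ∷_))
step-embed b (pop i p q r ∷ K , σ) with lookup (insertEmpty σ) (relabel i) | lookup σ i | lookup-insertEmpty σ i
... | _ | []        | refl = refl
... | _ | false ∷ w | refl = cong (_ ,_) (insertEmpty-%= σ i _)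
... | _ | true ∷ w  | refl = cong (_ ,_) (insertEmpty-%= σ i _)
step-embed true  (toss p q ∷ K , σ) = refl
step-embed false (toss p q ∷ K , σ) = refl
step-embed b ((p ⨾ q) ∷ K    , σ) = refl
step-embed b (while i p ∷ K  , σ) with lookup (insertEmpty σ) (relabel i) | lookup σ i | lookup-insertEmpty σ i
... | _ | []    | refl = refl
... | _ | _ ∷ _ | refl = refl

run-embed : ∀ {s t} (coins : Vec Bool t) (S : State (suc s)) → run coins (embedState S) ≡ embedState (run coins S)
run-embed []          S = refl
run-embed (b ∷ coins) S = trans (cong (run coins) (step-embed b S)) (run-embed coins (step b S))

accepting-embed : ∀ {s} (S : State (suc s)) → accepting (embedState S) ≡ accepting S
accepting-embed ([]    , [] ∷ _)          = refl
accepting-embed ([]    , (true ∷ _) ∷ _)  = refl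
accepting-embed ([]    , (false ∷ _) ∷ _) = refl
accepting-embed (_ ∷ _ , _)               = refl

halted-step : ∀ {s} b (S : State s) → proj₁ S ≡ [] → step b S ≡ S
halted-step b ([] , σ) refl = refl

-- Copying, reading and rewriting the encoding

emit : ∀ {s} → List Bool → Program (3 + s)
emit []       = skip
emit (b ∷ bs) = push (suc zero) b ⨾ emit bs

-- The continuation is a function of the metalanguage, so the program unfolds into a tree with a
-- separate leaf for every bit vector: what depends on the bits is fixed when the program is built.
-- The `skip` answers an empty stack, which an encoded game never presents here.
read : ∀ {s} n → (Vec Bool n → Program (3 + s)) → Program (3 + s)
read zero    κ = κ []
read (suc n) κ = pop zero skip (read n (κ ∘ (false ∷_))) (read n (κ ∘ (true ∷_)))

readRows : ∀ {s} n k → (Vec (Vec Bool k) n → Program (3 + s)) → Program (3 + s)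
readRows zero    k κ = κ []
readRows (suc n) k κ = read k λ row → readRows n k λ rows → κ (row ∷ rows)

rowsBits : ∀ {n k} → Vec (Vec Bool k) n → List Bool
rowsBits []           = []
rowsBits (row ∷ rows) = Vec.toList row ++ rowsBits rows

-- As `while` can only test for emptiness, the end of a unary number is signalled by the flag: the
-- closing 0 is copied like the 1s, and then the flag is popped.
copyBit : ∀ {s} → Program (3 + s)
copyBit = pop zero skip
  (push (suc zero) false ⨾ pop (suc (suc zero)) skip skip skip)
  (push (suc zero) true)

copyUnary : ∀ {s} → Program (3 + s)
copyUnary = push (suc (suc zero)) true ⨾ while (suc (suc zero)) copyBit

moveBack : ∀ {s} → Program (3 + s)
moveBack = while (suc zero) (pop (suc zero) skip (push zero false) (push zero true))

-- choice M c is the text that replaces the matrix M when the coin shows c.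
module _ {k} (choice : Vec (Vec Bool k) k → Bool → List Bool) where

  rewriteEdge : ∀ {s} → Program (3 + s)
  rewriteEdge = copyUnary ⨾ copyUnary ⨾
    readRows k k λ M → toss (emit (choice M true)) (emit (choice M false))

  rewriteThen : ∀ {s} → Program (suc s) → Program (3 + s)
  rewriteThen p = copyUnary ⨾ copyUnary ⨾ copyUnary ⨾ while zero rewriteEdge ⨾ moveBack ⨾ embed p

  edgeInput : ℕ → ℕ → Vec (Vec Bool k) k → List Bool
  edgeInput a b M = unary a ++ unary b ++ rowsBits M

  edgeOutput : ℕ → ℕ → Vec (Vec Bool k) k → Bool → List Bool
  edgeOutput a b M c = unary a ++ unary b ++ choice M c

-- The last argument t is the time of the subsequent computation, x bounds the
-- numbers written in unary and ℓ the length of the text chosen for an edge.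

copyTime : ℕ → ℕ → ℕ
copyTime x t = 2 + (x * 3 + (7 + t))

edgeTime : ℕ → ℕ → ℕ → ℕ → ℕ
edgeTime x k ℓ t = suc (copyTime x (suc (copyTime x (k * k + suc (ℓ * 2 + suc t)))))

loopTime : ℕ → ℕ → ℕ → ℕ → ℕ → ℕ
loopTime x k ℓ zero    t = suc t
loopTime x k ℓ (suc m) t = suc (edgeTime x k ℓ (loopTime x k ℓ m t))

rewriteTime : ℕ → ℕ → ℕ → ℕ → ℕ → ℕ → ℕ
rewriteTime x k ℓ m L t =
  suc (copyTime x (suc (copyTime x (suc (copyTime x (suc (loopTime x k ℓ m (suc (L * 3 + suc t)))))))))

-- Running time and acceptance probability of the rewriting program

module Execution {c ℓ₁ ℓ₂ ℓ₃} (ℝ : ArchimedeanOrderedField c ℓ₁ ℓ₂ ℓ₃) where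
  open OrderedField ℝ

  Pr : ∀ {s} → State (suc s) → ℕ → Carrier
  Pr S t = 𝔼 ℝ (bernoulli ℝ ½ t) (λ coins → indicator ℝ (accepting (run coins S)))

  -- Time is counted back from the end of the run. A lemma about a program fragment extends the
  -- bound for whatever follows it by the cost of the fragment, and carries the acceptance
  -- probability along.
  record Yields {s} (S : State (suc s)) (t : ℕ) (v : Carrier) : Set (c ⊔ ℓ₁) where
    field
      halts : (coins : Vec Bool t) → proj₁ (run coins S) ≡ []
      value : Pr S t ≈ v
  open Yields public

  private variable
    s t t′ : ℕ
    S S′ : State (suc s)
    K : List (Program (3 + s))
    w inp : List Bool
    r : Vec (List Bool) s
    v v₀ v₁ : Carrier

  resp : v₀ ≈ v₁ → Yields S t v₀ → Yields S t v₁
  resp v₀≈v₁ Y = record { halts = halts Y ; value = ≈-trans (value Y) v₀≈v₁ }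

  branch : Yields (step true S) t v₁ → Yields (step false S) t v₀ → Yields S (suc t) (average v₁ v₀)
  branch {t = t} Y₁ Y₀ = record
    { halts = λ { (true ∷ coins) → halts Y₁ coins ; (false ∷ coins) → halts Y₀ coins }
    ; value = ≈-trans (𝔼-bernoulli-suc ½ t _) (average-cong (value Y₁) (value Y₀))
    }

  tickTo : (∀ b → step b S ≡ S′) → Yields S′ t v → Yields S (suc t) v
  tickTo eq Y = resp (average-same _) (branch (subst (λ S → Yields S _ _) (sym (eq true)) Y)
    (subst (λ S → Yields S _ _) (sym (eq false)) Y))

  tick : step true S ≡ step false S → Yields (step true S) t v → Yields S (suc t) v
  tick eq = tickTo λ { true → refl ; false → sym eq }

  -- A halted state ignores further coins, so a time bound can be raised without changing the value;
  -- this is how runs of different lengths get a common bound.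
  wait : Yields S t v → Yields S (suc t) v
  wait {S = S} {t = zero}  Y = tickTo (λ b → halted-step b S (halts Y [])) Y
  wait {S = S} {t = suc t} Y =
    resp (≈-trans (≈-sym (𝔼-bernoulli-suc ½ t _)) (value Y)) (branch (wait (after true)) (wait (after false)))
    where
    after : ∀ b → Yields (step b S) t (Pr (step b S) t)
    after b = record { halts = halts Y ∘ (b ∷_) ; value = ≈-refl }

  waitFor : ∀ n → Yields S t v → Yields S (n + t) v
  waitFor zero    Y = Y
  waitFor (suc n) Y = wait (waitFor n Y)

  within : t ≤ t′ → Yields S t v → Yields S t′ v
  within {t} {t′} t≤t′ Y = subst (λ t → Yields _ t _) (ℕ.m∸n+n≡m t≤t′) (waitFor (t′ ∸ t) Y)

  embed-yields : (∀ coins → proj₁ (run {t = t} coins S) ≡ []) → Yields (embedState S) t (Pr S t)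
  embed-yields {t = t} {S = S} h = record
    { halts = λ coins → trans (cong proj₁ (run-embed coins S)) (cong (List.map embed) (h coins))
    ; value = 𝔼-cong (bernoulli ℝ ½ t) λ coins → reflexive (cong (indicator ℝ)
        (trans (cong accepting (run-embed coins S)) (accepting-embed (run coins S))))
    }

  emit-yields : ∀ l → Yields (K , inp ∷ (l ʳ++ w) ∷ [] ∷ r) t v →
                Yields (emit l ∷ K , inp ∷ w ∷ [] ∷ r) (length l * 2 + suc t) v
  emit-yields []       Y = tick refl Y
  emit-yields (b ∷ bs) Y = tick refl (tick refl (emit-yields bs Y))

  read-yields : ∀ {n} κ (bits : Vec Bool n) → Yields (κ bits ∷ K , inp ∷ w ∷ [] ∷ r) t v →
                Yields (read n κ ∷ K , (Vec.toList bits ++ inp) ∷ w ∷ [] ∷ r) (n + t) v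
  read-yields κ []             Y = Y
  read-yields κ (true ∷ bits)  Y = tick refl (read-yields (κ ∘ (true ∷_)) bits Y)
  read-yields κ (false ∷ bits) Y = tick refl (read-yields (κ ∘ (false ∷_)) bits Y)

  readRows-yields : ∀ {n k} κ (rows : Vec (Vec Bool k) n) → Yields (κ rows ∷ K , inp ∷ w ∷ [] ∷ r) t v →
                    Yields (readRows n k κ ∷ K , (rowsBits rows ++ inp) ∷ w ∷ [] ∷ r) (n * k + t) v
  readRows-yields         κ []           Y = Y
  readRows-yields {inp = inp} {t = t} {n = suc n} {k} κ (row ∷ rows) Y
    rewrite List.++-assoc (Vec.toList row) (rowsBits rows) inp | ℕ.+-assoc k (n * k) t =
    read-yields _ row (readRows-yields (λ rows → κ (row ∷ rows)) rows Y)

  copyUnary-yields : ∀ a → Yields (K , inp ∷ (unary a ʳ++ w) ∷ [] ∷ r) t v →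
                     Yields (copyUnary ∷ K , (unary a ++ inp) ∷ w ∷ [] ∷ r) (2 + (a * 3 + (7 + t))) v
  copyUnary-yields a Y = tick refl (tick refl (loop a Y))
    where
    loop : ∀ a {K inp w r} → Yields (K , inp ∷ (unary a ʳ++ w) ∷ [] ∷ r) t v →
           Yields (while (suc (suc zero)) copyBit ∷ K , (unary a ++ inp) ∷ w ∷ (true ∷ []) ∷ r) (a * 3 + (7 + t)) v
    -- The seven steps are the loop test, the pop of the closing 0, the sequencing, the push, the
    -- pop of the flag, `skip`, and the final loop test.
    loop zero    Y = tick refl (tick refl (tick refl (tick refl (tick refl
                       (tick refl (tick refl Y))))))
    loop (suc a) Y = tick refl (tick refl (tick refl (loop a Y)))

  moveBack-yields : ∀ w → Yields (K , (w ʳ++ inp) ∷ [] ∷ [] ∷ r) t v →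
                    Yields (moveBack ∷ K , inp ∷ w ∷ [] ∷ r) (length w * 3 + suc t) v
  moveBack-yields []          Y = tick refl Y
  moveBack-yields (true ∷ w)  Y = tick refl (tick refl (tick refl (moveBack-yields w Y)))
  moveBack-yields (false ∷ w) Y = tick refl (tick refl (tick refl (moveBack-yields w Y)))

  copyUnary-within : ∀ {a x} → a ≤ x → Yields (K , inp ∷ (unary a ʳ++ w) ∷ [] ∷ r) t v →
                     Yields (copyUnary ∷ K , (unary a ++ inp) ∷ w ∷ [] ∷ r) (copyTime x t) v
  copyUnary-within a≤x Y = within (ℕ.+-monoʳ-≤ 2 (ℕ.+-monoˡ-≤ _ (ℕ.*-monoˡ-≤ 3 a≤x))) (copyUnary-yields _ Y)

  module _ {k} (choice : Vec (Vec Bool k) k → Bool → List Bool) {ℓ} (length≤ : ∀ M c → length (choice M c) ≤ ℓ) where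

    rewriteEdge-yields : ∀ {a b x} M {v : Bool → Carrier} → a ≤ x → b ≤ x →
      (∀ c → Yields (K , inp ∷ (edgeOutput choice a b M c ʳ++ w) ∷ [] ∷ r) t (v c)) →
      Yields (rewriteEdge choice ∷ K , (edgeInput choice a b M ++ inp) ∷ w ∷ [] ∷ r) (edgeTime x k ℓ t)
        (average (v true) (v false))
    rewriteEdge-yields {K = K} {inp = inp} {w = w} {r = r} {t = t} {a = a} {b} M {v} a≤x b≤x Y
      rewrite List.++-assoc (unary a) (unary b ++ rowsBits M) inp | List.++-assoc (unary b) (rowsBits M) inp =
      tick refl (copyUnary-within a≤x (tick refl (copyUnary-within b≤x (readRows-yields _ M
        (branch (emitted true) (emitted false))))))
      where
      -- The two texts may differ in length, but the branches of a toss must share a bound; both are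
      -- padded to `ℓ`.
      emitted : ∀ c → Yields (emit (choice M c) ∷ K , inp ∷ (unary b ʳ++ (unary a ʳ++ w)) ∷ [] ∷ r) (ℓ * 2 + suc t) (v c)
      emitted c = within (ℕ.+-monoˡ-≤ (suc t) (ℕ.*-monoˡ-≤ 2 (length≤ M c)))
        (emit-yields (choice M c) (subst (λ w → Yields (K , inp ∷ w ∷ [] ∷ r) t (v c))
          (trans (List.++-ʳ++ (unary a)) (List.++-ʳ++ (unary b))) (Y c)))

    -- The tosses for successive edges unfold `bernoulli ℝ ½ m` coordinate by coordinate, which
    -- turns the coins of the run into the vector that selects the matchings.
    rewriteEdges-yields : ∀ {m x} (a b : Fin m → ℕ) (M : Fin m → Vec (Vec Bool k) k) {v : Vec Bool m → Carrier} →
      (∀ e → a e ≤ x) → (∀ e → b e ≤ x) →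
      (∀ c → Yields (K , [] ∷ (List.concat (List.tabulate λ e → edgeOutput choice (a e) (b e) (M e) (lookup c e)) ʳ++ w) ∷ [] ∷ r) t (v c)) →
      Yields (while zero (rewriteEdge choice) ∷ K ,
        List.concat (List.tabulate λ e → edgeInput choice (a e) (b e) (M e)) ∷ w ∷ [] ∷ r)
        (loopTime x k ℓ m t) (𝔼 ℝ (bernoulli ℝ ½ m) v)
    rewriteEdges-yields {m = zero}  a b M {v} a≤x b≤x Y = tick refl (resp (≈-sym (𝔼-return [] v)) (Y []))
    rewriteEdges-yields {w = w} {m = suc m} a b M {v} a≤x b≤x Y =
      resp (≈-sym (𝔼-bernoulli-suc ½ m v)) (tickTo (enter (a zero))
        (rewriteEdge-yields (M zero) (a≤x zero) (b≤x zero) λ c →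
          rewriteEdges-yields (a ∘ suc) (b ∘ suc) (M ∘ suc) (a≤x ∘ suc) (b≤x ∘ suc) λ cs →
            subst (λ w → Yields (_ , [] ∷ w ∷ [] ∷ _) _ _) (List.++-ʳ++ (edgeOutput choice (a zero) (b zero) (M zero) c)) (Y (c ∷ cs))))
      where
      -- The text of an edge begins with a unary number, which even for 0 has one bit, so the loop
      -- cannot end before the last edge.
      enter : ∀ {s p K} {bs bs′ : List Bool} {σ : Vec (List Bool) s} a bit →
              step bit (while zero p ∷ K , ((unary a ++ bs) ++ bs′) ∷ σ) ≡ (p ∷ while zero p ∷ K , ((unary a ++ bs) ++ bs′) ∷ σ)
      enter zero    _ = refl
      enter (suc _) _ = refl

    rewriteThen-yields : ∀ (p : Program (suc s)) {m h₁ h₂ h₃ x L} (a b : Fin m → ℕ) (M : Fin m → Vec (Vec Bool k) k) →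
      h₁ ≤ x → h₂ ≤ x → h₃ ≤ x → (∀ e → a e ≤ x) → (∀ e → b e ≤ x) →
      let output cs = unary h₁ ++ unary h₂ ++ unary h₃ ++
            List.concat (List.tabulate λ e → edgeOutput choice (a e) (b e) (M e) (lookup cs e)) in
      (∀ cs → length (output cs) ≤ L) → (∀ cs → HaltsWithin (s , p) t (output cs)) →
      Yields (initial (rewriteThen choice p) (unary h₁ ++ unary h₂ ++ unary h₃ ++
          List.concat (List.tabulate λ e → edgeInput choice (a e) (b e) (M e))))
        (rewriteTime x k ℓ m L t)
        (𝔼 ℝ (bernoulli ℝ ½ m) λ cs → Pr (initial p (output cs)) t)
    rewriteThen-yields {t = t} p {h₁ = h₁} {h₂} {h₃} {L = L} a b M h₁≤x h₂≤x h₃≤x a≤x b≤x output≤ halting =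
      tick refl (copyUnary-within h₁≤x (tick refl (copyUnary-within h₂≤x (tick refl (copyUnary-within h₃≤x
        (tick refl (rewriteEdges-yields a b M a≤x b≤x λ cs → tick refl (moved cs))))))))
      where
      output : Vec Bool _ → List Bool
      output cs = unary h₁ ++ unary h₂ ++ unary h₃ ++
        List.concat (List.tabulate λ e → edgeOutput choice (a e) (b e) (M e) (lookup cs e))

      reversed : ∀ tail → (unary h₁ ++ unary h₂ ++ unary h₃ ++ tail) ʳ++ [] ≡ tail ʳ++ (unary h₃ ʳ++ (unary h₂ ʳ++ (unary h₁ ʳ++ [])))
      reversed tail = trans (List.++-ʳ++ (unary h₁)) (trans (List.++-ʳ++ (unary h₂)) (List.++-ʳ++ (unary h₃)))

      moved : ∀ cs → Yields (moveBack ∷ embed p ∷ [] , [] ∷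
        (List.concat (List.tabulate λ e → edgeOutput choice (a e) (b e) (M e) (lookup cs e)) ʳ++
          (unary h₃ ʳ++ (unary h₂ ʳ++ (unary h₁ ʳ++ [])))) ∷ [] ∷ Vec.replicate _ []) (L * 3 + suc t)
        (Pr (initial p (output cs)) t)
      moved cs = subst (λ w → Yields (moveBack ∷ embed p ∷ [] , [] ∷ w ∷ [] ∷ Vec.replicate _ []) (L * 3 + suc t) (Pr (initial p (output cs)) t))
        (reversed _)
        (within (ℕ.+-monoˡ-≤ (suc t) (ℕ.*-monoˡ-≤ 3 length≤L)) (moveBack-yields (output cs ʳ++ [])
          (subst (λ u → Yields (embed p ∷ [] , u ∷ [] ∷ [] ∷ Vec.replicate _ []) t (Pr (initial p (output cs)) t)) (sym restored)
            (embed-yields (halting cs)))))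
        where
        -- The second reversal restores the order, and stacks 1 and 2 are empty again, as
        -- `embedState` requires.
        restored : (output cs ʳ++ []) ʳ++ [] ≡ output cs
        restored = trans (List.ʳ++-ʳ++ (output cs)) (List.++-identityʳ (output cs))

        length≤L : length (output cs ʳ++ []) ≤ L
        length≤L = subst (_≤ L) (sym (trans (List.length-ʳ++ (output cs)) (ℕ.+-identityʳ _))) (output≤ cs)

-- Running times

-- Starting at 2 lets the exponent absorb constants, by `c ≤ 2 ^ c`, and lets a sum cost only one
-- more factor `x`. A game with an edge has size at least 2.
PolynomiallyBounded : (ℕ → ℕ) → Set
PolynomiallyBounded f = ∃[ d ] ∀ x → 2 ≤ x → f x ≤ x ^ d

private
  2≤⇒nonZero : ∀ {x} → 2 ≤ x → NonZero x
  2≤⇒nonZero (s≤s _) = _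

bounded-const : ∀ c → PolynomiallyBounded (λ _ → c)
bounded-const c = c , λ x 2≤x → ℕ.≤-trans (ℕ.<⇒≤ (n<2^n c)) (ℕ.^-monoˡ-≤ c 2≤x)
  where
  n<2^n : ∀ n → suc n ≤ 2 ^ n
  n<2^n zero    = ℕ.≤-refl
  n<2^n (suc n) = ℕ.+-mono-≤ (ℕ.m^n>0 2 n) (subst (suc n ≤_) (sym (ℕ.+-identityʳ _)) (n<2^n n))

bounded-^ : ∀ d → PolynomiallyBounded (_^ d)
bounded-^ d = d , λ _ _ → ℕ.≤-refl

bounded-id : PolynomiallyBounded (λ x → x)
bounded-id = 1 , λ x _ → ℕ.≤-reflexive (sym (ℕ.*-identityʳ x))

bounded-* : ∀ {f g} → PolynomiallyBounded f → PolynomiallyBounded g → PolynomiallyBounded (λ x → f x * g x)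
bounded-* (d , f≤) (e , g≤) = d + e , λ x 2≤x →
  ℕ.≤-trans (ℕ.*-mono-≤ (f≤ x 2≤x) (g≤ x 2≤x)) (ℕ.≤-reflexive (sym (ℕ.^-distribˡ-+-* x d e)))

bounded-+ : ∀ {f g} → PolynomiallyBounded f → PolynomiallyBounded g → PolynomiallyBounded (λ x → f x + g x)
bounded-+ {f} {g} (d , f≤) (e , g≤) = suc (d + e) , λ x 2≤x → let instance _ = 2≤⇒nonZero 2≤x in
  ℕ.≤-trans (ℕ.+-mono-≤ (ℕ.≤-trans (f≤ x 2≤x) (ℕ.^-monoʳ-≤ x (ℕ.m≤m+n d e)))
                        (ℕ.≤-trans (g≤ x 2≤x) (ℕ.^-monoʳ-≤ x (ℕ.m≤n+m e d))))
    (ℕ.≤-trans (ℕ.≤-reflexive (cong (x ^ (d + e) +_) (sym (ℕ.+-identityʳ _)))) (ℕ.*-monoˡ-≤ (x ^ (d + e)) 2≤x))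

outputLength : ℕ → ℕ → ℕ
outputLength ℓ x = 3 * (x + 1) + x * (2 * (x + 1) + ℓ)

-- The header costs `9 + 3x` for each of its three numbers, five sequencings and two loop exits make
-- up the rest of 34, each bit moved back costs 3, and the last factor is the cost of one edge.
overhead : ℕ → ℕ → ℕ → ℕ
overhead k ℓ x = 34 + x * 9 + (outputLength ℓ x * 3 + x * (23 + x * 6 + k * k + ℓ * 2))

overhead-bounded : ∀ k ℓ → PolynomiallyBounded (overhead k ℓ)
overhead-bounded k ℓ =
  bounded-+ (bounded-+ (bounded-const 34) (bounded-* bounded-id (bounded-const 9)))
    (bounded-+ (bounded-*
        (bounded-+ (bounded-* (bounded-const 3) (bounded-+ bounded-id (bounded-const 1)))
          (bounded-* bounded-id (bounded-+ (bounded-* (bounded-const 2) (bounded-+ bounded-id (bounded-const 1))) (bounded-const ℓ))))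
        (bounded-const 3))
      (bounded-* bounded-id (bounded-+ (bounded-+ (bounded-+ (bounded-const 23) (bounded-* bounded-id (bounded-const 6))) (bounded-const (k * k))) (bounded-const (ℓ * 2)))))

loopTime≡ : ∀ x k ℓ m t → loopTime x k ℓ m t ≡ suc t + m * (23 + x * 6 + k * k + ℓ * 2)
loopTime≡ x k ℓ zero    t = sym (ℕ.+-identityʳ _)
loopTime≡ x k ℓ (suc m) t = trans (cong (λ u → suc (edgeTime x k ℓ u)) (loopTime≡ x k ℓ m t)) (arith x (k * k) (ℓ * 2) m t)
  where
  arith : ∀ x kk ll m t → suc (suc (2 + (x * 3 + (7 + suc (2 + (x * 3 + (7 + (kk + suc (ll + suc (suc t + m * (23 + x * 6 + kk + ll)))))))))))
          ≡ suc t + suc m * (23 + x * 6 + kk + ll)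
  arith = solve-∀

rewriteTime≤ : ∀ {x k ℓ m t} → m ≤ x → rewriteTime x k ℓ m (outputLength ℓ x) t ≤ overhead k ℓ x + t
rewriteTime≤ {x} {k} {ℓ} {m} {t} m≤x = ℕ.≤-trans (ℕ.≤-reflexive
  (trans (cong (λ u → suc (copyTime x (suc (copyTime x (suc (copyTime x (suc u))))))) (loopTime≡ x k ℓ m _))
    (arith x (outputLength ℓ x * 3) (m * (23 + x * 6 + k * k + ℓ * 2)) t)))
  (ℕ.+-monoˡ-≤ t (ℕ.+-monoʳ-≤ (34 + x * 9) (ℕ.+-monoʳ-≤ (outputLength ℓ x * 3) (ℕ.*-monoˡ-≤ _ m≤x))))
  where
  arith : ∀ x L u t → suc (2 + (x * 3 + (7 + suc (2 + (x * 3 + (7 + suc (2 + (x * 3 + (7 + suc (suc (suc (L + suc t)) + u))))))))))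
          ≡ 34 + x * 9 + (L + u) + t
  arith = solve-∀

-- The reduction

concatMap-allFin : ∀ {A : Set} {n} (f : Fin n → List A) → concatMap f (allFin n) ≡ List.concat (List.tabulate f)
concatMap-allFin f = cong List.concat (List.map-tabulate id f)

length-concat-tabulate≤ : ∀ {A : Set} {n L} (f : Fin n → List A) → (∀ i → length (f i) ≤ L) →
                          length (List.concat (List.tabulate f)) ≤ n * L
length-concat-tabulate≤ {n = zero}  f f≤ = z≤n
length-concat-tabulate≤ {n = suc n} f f≤ = ℕ.≤-trans (ℕ.≤-reflexive (List.length-++ (f zero)))
  (ℕ.+-mono-≤ (f≤ zero) (length-concat-tabulate≤ (f ∘ suc) (f≤ ∘ suc)))

length-unary : ∀ a → length (unary a) ≡ a + 1
length-unary zero    = refl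
length-unary (suc a) = cong suc (length-unary a)

Matrix : ℕ → Set
Matrix k = Vec (Vec Bool k) k

entry : ∀ {k} → Matrix k → Fin k → Fin k → Bool
entry M i j = lookup (lookup M i) j

toMatrix : ∀ {k} → (Fin k → Fin k → Bool) → Matrix k
toMatrix f = tabulate λ i → tabulate (f i)

entry-toMatrix : ∀ {k} (f : Fin k → Fin k → Bool) i j → entry (toMatrix f) i j ≡ f i j
entry-toMatrix f i j = trans (cong (λ row → lookup row j) (Vec.lookup∘tabulate _ i)) (Vec.lookup∘tabulate _ j)

rowsBits-tabulate : ∀ {n k} (f : Fin n → Fin k → Bool) →
  rowsBits (tabulate λ i → tabulate (f i)) ≡ List.concat (List.tabulate λ i → List.map (f i) (allFin k))
rowsBits-tabulate {zero}  f = refl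
rowsBits-tabulate {suc n} f = cong₂ _++_ (trans (toList-tabulate (f zero)) (sym (List.map-tabulate id (f zero))))
  (rowsBits-tabulate (f ∘ suc))
  where
  toList-tabulate : ∀ {k} (g : Fin k → Bool) → Vec.toList (tabulate g) ≡ List.tabulate g
  toList-tabulate {zero}  g = refl
  toList-tabulate {suc k} g = cong (g zero ∷_) (toList-tabulate (g ∘ suc))

-- A total function of the matrix alone, since the decision tree has a leaf for every matrix; the
-- identity fills the leaves that no 2-to-2 constraint reaches.
matchings : ∀ {k} → Matrix k → Bool → Permutation′ k
matchings M with twoRegular? (entry M)
... | yes regular = proj₁ (decompose regular)
... | no  _       = const Permutation.id

matchings-union : ∀ {k} (M : Matrix k) → TwoRegular (entry M) → IsUnionOf (entry M) (matchings M)
matchings-union M regular with twoRegular? (entry M)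
... | yes regular′ = proj₂ (decompose regular′)
... | no ¬regular  = contradiction regular ¬regular

encodePermutation : ∀ {k} → Permutation′ k → List Bool
encodePermutation {k} σ = concatMap (λ i → unary (toℕ (σ ⟨$⟩ʳ i))) (allFin k)

length-encodePermutation : ∀ {k} (σ : Permutation′ k) → length (encodePermutation σ) ≤ k * k
length-encodePermutation {k} σ = subst (λ l → length l ≤ k * k) (sym (concatMap-allFin letter))
  (length-concat-tabulate≤ letter λ i →
    subst (_≤ k) (trans (ℕ.+-comm 1 _) (sym (length-unary (toℕ (σ ⟨$⟩ʳ i))))) (Fin.toℕ<n (σ ⟨$⟩ʳ i)))
  where
  letter : Fin k → List Bool
  letter i = unary (toℕ (σ ⟨$⟩ʳ i))

matchingText : ∀ {k} → Matrix k → Bool → List Bool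
matchingText M c = encodePermutation (matchings M c)

module Reduction {k} (I : TwoToTwoGame k) where
  open TwoToTwoGame I

  size : ℕ
  size = n + m + k

  matching : Fin m → Bool → Permutation′ k
  matching e = matchings (toMatrix (Π e))

  matrix-regular : ∀ e → TwoRegular (entry (toMatrix (Π e)))
  matrix-regular e =
    (λ i → trans (cong ∣_∣ (Vec.tabulate-cong (entry-toMatrix (Π e) i))) (two-to-r e i)) ,
    (λ j → trans (cong ∣_∣ (Vec.tabulate-cong λ i → entry-toMatrix (Π e) i j)) (two-to-l e j))

  matching-union : ∀ e → IsUnionOf (Π e) (matching e)
  matching-union e with sound , complete ← matchings-union (toMatrix (Π e)) (matrix-regular e) =
    (λ b i → trans (sym (entry-toMatrix (Π e) i _)) (sound b i)) ,
    (λ i j p → complete i j (trans (entry-toMatrix (Π e) i j) p))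

  uniqueGame : Vec Bool m → UniqueGame
  uniqueGame cs = record { graph = graph ; π = λ e → matching e (lookup cs e) }

  source target : Fin m → ℕ
  source e = toℕ (src e)
  target e = toℕ (tgt e)

  matrix : Fin m → Matrix k
  matrix e = toMatrix (Π e)

  encode22≡ : encode22 I ≡ unary n ++ unary m ++ unary k ++
              List.concat (List.tabulate λ e → edgeInput matchingText (source e) (target e) (matrix e))
  encode22≡ = cong (λ l → unary n ++ unary m ++ unary k ++ l) (trans
    (concatMap-allFin λ e → unary (source e) ++ unary (target e) ++ concatMap (λ i → List.map (Π e i) (allFin k)) (allFin k))
    (cong List.concat (List.tabulate-cong λ e → cong (λ l → unary (source e) ++ unary (target e) ++ l)
      (trans (concatMap-allFin λ i → List.map (Π e i) (allFin k)) (sym (rowsBits-tabulate (Π e)))))))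

  encodeUG≡ : ∀ cs → encodeUG (uniqueGame cs) ≡ unary n ++ unary m ++ unary k ++
              List.concat (List.tabulate λ e → edgeOutput matchingText (source e) (target e) (matrix e) (lookup cs e))
  encodeUG≡ cs = cong (λ l → unary n ++ unary m ++ unary k ++ l)
    (concatMap-allFin λ e → edgeOutput matchingText (source e) (target e) (matrix e) (lookup cs e))

  n≤ : n ≤ size
  n≤ = ℕ.≤-trans (ℕ.m≤m+n n m) (ℕ.m≤m+n (n + m) k)

  m≤ : m ≤ size
  m≤ = ℕ.≤-trans (ℕ.m≤n+m m n) (ℕ.m≤m+n (n + m) k)

  k≤ : k ≤ size
  k≤ = ℕ.m≤n+m k (n + m)

  2≤size : 2 ≤ size
  2≤size = ℕ.≤-trans (ℕ.+-mono-≤ (1≤n nonempty src) nonempty) (ℕ.m≤m+n (n + m) k)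
    where
    1≤n : ∀ {m n} → 1 ≤ m → (Fin m → Fin n) → 1 ≤ n
    1≤n {suc _} {zero}  _ f with () ← f zero
    1≤n {suc _} {suc _} _ f = s≤s z≤n

  source≤ : ∀ e → source e ≤ size
  source≤ e = ℕ.≤-trans (ℕ.<⇒≤ (Fin.toℕ<n (src e))) n≤

  target≤ : ∀ e → target e ≤ size
  target≤ e = ℕ.≤-trans (ℕ.<⇒≤ (Fin.toℕ<n (tgt e))) n≤

  length-++≤ : ∀ {i L l} → i ≤ size → length l ≤ L → length (unary i ++ l) ≤ (size + 1) + L
  length-++≤ {i} i≤ l≤ = ℕ.≤-trans (ℕ.≤-reflexive (List.length-++ (unary i)))
    (ℕ.+-mono-≤ (subst (_≤ size + 1) (sym (length-unary i)) (ℕ.+-monoˡ-≤ 1 i≤)) l≤)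

  length-output≤ : ∀ cs → length (unary n ++ unary m ++ unary k ++
    List.concat (List.tabulate λ e → edgeOutput matchingText (source e) (target e) (matrix e) (lookup cs e)))
    ≤ outputLength (k * k) size
  length-output≤ cs = ℕ.≤-trans
    (length-++≤ n≤ (length-++≤ m≤ (length-++≤ k≤ (ℕ.≤-trans
      (length-concat-tabulate≤ _ λ e →
        length-++≤ (source≤ e) (length-++≤ (target≤ e) (length-encodePermutation (matching e (lookup cs e)))))
      (ℕ.*-monoˡ-≤ _ m≤)))))
    (ℕ.≤-reflexive (arith size (k * k)))
    where
    arith : ∀ x ℓ → (x + 1) + ((x + 1) + ((x + 1) + x * ((x + 1) + ((x + 1) + ℓ)))) ≡ 3 * (x + 1) + x * (2 * (x + 1) + ℓ)
    arith = solve-∀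

  satisfied⊆ : ∀ cs x → ∣ UniqueGame.satisfied (uniqueGame cs) x ∣ ≤ ∣ satisfied x ∣
  satisfied⊆ cs x = Subset.p⊆q⇒∣p∣≤∣q∣ {p = UniqueGame.satisfied (uniqueGame cs) x} {q = satisfied x} λ {e} e∈ →
    Vec.lookup⇒[]= e (satisfied x) (trans (Vec.lookup∘tabulate _ e)
      (sat e (trans (sym (Vec.lookup∘tabulate (λ e → does (x (tgt e) Fin.≟ matching e (lookup cs e) ⟨$⟩ʳ x (src e))) e))
        (Vec.[]=⇒lookup e∈))))
    where
    sat : ∀ e → does (x (tgt e) Fin.≟ matching e (lookup cs e) ⟨$⟩ʳ x (src e)) ≡ true → Π e (x (src e)) (x (tgt e)) ≡ true
    sat e p with yes eq ← x (tgt e) Fin.≟ matching e (lookup cs e) ⟨$⟩ʳ x (src e) =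
      trans (cong (Π e (x (src e))) eq) (proj₁ (matching-union e) (lookup cs e) (x (src e)))

  module _ (satisfiable : CompletelySatisfiable satisfied) where

    private
      x : Fin n → Fin k
      x = proj₁ satisfiable

      correct : ∀ e → ∃[ b ] x (tgt e) ≡ matching e b ⟨$⟩ʳ x (src e)
      correct e = proj₂ (matching-union e) _ _ (trans (sym (Vec.lookup∘tabulate _ e))
        (trans (cong (λ p → lookup p e) (proj₂ satisfiable)) (Vec.lookup-replicate e true)))

    correctChoice : Vec Bool m
    correctChoice = tabulate (proj₁ ∘ correct)

    correctChoice-satisfiable : CompletelySatisfiable (UniqueGame.satisfied (uniqueGame correctChoice))
    correctChoice-satisfiable = x , trans (Vec.tabulate-cong λ e → dec-true (_ Fin.≟ _)
      (trans (proj₂ (correct e)) (cong (λ b → matching e b ⟨$⟩ʳ x (src e)) (sym (Vec.lookup∘tabulate _ e)))))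
      (allTrue m)
      where
      allTrue : ∀ m → tabulate {n = m} (λ _ → true) ≡ ⊤
      allTrue zero    = refl
      allTrue (suc m) = cong (true ∷_) (allTrue m)

-- Transfer of the distinguishing advantage

module Reduce {c ℓ₁ ℓ₂ ℓ₃} (ℝ : ArchimedeanOrderedField c ℓ₁ ℓ₂ ℓ₃) where
  open OrderedField ℝ
  open Execution ℝ

  module _ (ε δ : Carrier) (½≤ε : ½ ≤ᴿ ε) (k : ℕ) where

    private
      SR = SemiRandomUG ℝ ε δ
      TT = TwoToTwoProblem ℝ k δ

    module _ (A : PolynomialTime ℝ SR) where

      private
        d = proj₁ (proj₂ A)
        p = proj₂ (proj₁ A)

        bounded : PolynomiallyBounded (λ x → overhead k (k * k) x + (x ^ d + d))
        bounded = bounded-+ (overhead-bounded k (k * k)) (bounded-+ (bounded-^ d) (bounded-const d))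

        D : ℕ
        D = proj₁ bounded

      accept : UniqueGame → Carrier
      accept = Pr-accept ℝ SR A

      module _ (I : TwoToTwoGame k) where
        open Reduction I
        open TwoToTwoGame I using (m)

        reduction-yields : Yields (initial (rewriteThen (matchingText {k}) p) (encode22 I)) (size ^ D + D)
          (𝔼 ℝ (bernoulli ℝ ½ m) (accept ∘ uniqueGame))
        reduction-yields = within
          (ℕ.≤-trans (rewriteTime≤ {size} {k} {k * k} {m} {size ^ d + d} m≤) (ℕ.≤-trans (proj₂ bounded size 2≤size) (ℕ.m≤m+n (size ^ D) D)))
          (subst (λ input → Yields (initial (rewriteThen (matchingText {k}) p) input)
              (rewriteTime size k (k * k) m (outputLength (k * k) size) (size ^ d + d)) (𝔼 ℝ (bernoulli ℝ ½ m) (accept ∘ uniqueGame)))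
            (sym encode22≡)
            (resp (𝔼-cong (bernoulli ℝ ½ m) λ cs → reflexive (cong (λ l → Pr (initial p l) (size ^ d + d)) (sym (encodeUG≡ cs))))
              (rewriteThen-yields matchingText (λ M c → length-encodePermutation (matchings M c)) p source target matrix
                n≤ m≤ k≤ source≤ target≤
                length-output≤
                (λ cs → subst (HaltsWithin (proj₁ A) (size ^ d + d)) (encodeUG≡ cs) (proj₂ (proj₂ A) (uniqueGame cs))))))

      reducing : PolynomialTime ℝ TT
      reducing = (_ , rewriteThen (matchingText {k}) p) , D , λ I → halts (reduction-yields I)

      accept-reducing : ∀ I → Pr-accept ℝ TT reducing I ≈ 𝔼 ℝ (bernoulli ℝ ½ (TwoToTwoGame.m I)) (accept ∘ Reduction.uniqueGame I)
      accept-reducing I = value (reduction-yields I)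

      module _ (I : TwoToTwoGame k) (satisfiable : CompletelySatisfiable (TwoToTwoGame.satisfied I)) where
        open Reduction I
        open TwoToTwoGame I using (m)

        private
          as : Vec Bool m
          as = correctChoice satisfiable

          replies : Vec Bool m → Fin m → Permutation′ k
          replies bs e = matching e (lookup (zipWith _xor_ as bs) e)

        -- The reply may ignore E_ε and draw a coin for every edge, because `corrupt` discards the
        -- replies outside E_ε.
        adversary : Adversary ℝ
        adversary = record
          { original    = uniqueGame as
          ; satisfiable = correctChoice-satisfiable satisfiable
          ; reply       = λ _ → record
            { weighted = _>>=_ ℝ (bernoulli ℝ (1/2ε ½≤ε) m) (λ bs → return ℝ (replies bs))
            ; nonneg   = >>=-nonneg (bernoulli-nonneg (0≤1/2ε ½≤ε) (0≤1-1/2ε ½≤ε) m) (λ bs → return-nonneg (replies bs))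
            ; total    = ≈-trans (𝔼-map (bernoulli ℝ (1/2ε ½≤ε) m) replies (λ _ → 1#)) (𝔼-bernoulli-const (1/2ε ½≤ε) m 1#)
            }
          }

        -- The constraints of the two games agree edge by edge, not as functions; `accept` sees them
        -- only through the encoding, for which that is enough.
        accept-corrupt : ∀ es bs → accept (Adversary.corrupt adversary es (replies bs)) ≡ accept (uniqueGame (flips as es bs))
        accept-corrupt es bs = cong (λ l → Pr (initial p l) (size ^ d + d))
          (cong (λ l → unary (TwoToTwoGame.n I) ++ unary m ++ unary k ++ l) (List.concatMap-cong
            (λ e → cong (λ l → unary (source e) ++ unary (target e) ++ l) (cong encodePermutation (same e))) (allFin m)))
          where
          pick : ∀ x y z (σ : Bool → Permutation′ k) → (if y then σ (x xor z) else σ x) ≡ σ (x xor (y ∧ z))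
          pick x true  z σ = refl
          pick x false z σ = cong σ (sym (Bool.xor-identityʳ x))
          same : ∀ e → (if lookup es e then replies bs e else matching e (lookup as e)) ≡ matching e (lookup (flips as es bs) e)
          same e rewrite Vec.lookup-zipWith _xor_ e as bs | Vec.lookup-zipWith _xor_ e as (zipWith _∧_ es bs)
            | Vec.lookup-zipWith _∧_ e es bs = pick (lookup as e) (lookup es e) (lookup bs e) (matching e)

        semiRandom-uniform : 𝔼 ℝ (semiRandom ℝ ε adversary) accept ≈ 𝔼 ℝ (bernoulli ℝ ½ m) (accept ∘ uniqueGame)
        semiRandom-uniform = ≈-trans (𝔼->>= (bernoulli ℝ ε m) _ accept) (≈-trans
          (𝔼-cong (bernoulli ℝ ε m) λ es → ≈-trans
            (𝔼-map (Distribution.weighted (Adversary.reply adversary es)) (Adversary.corrupt adversary es) accept)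
            (≈-trans (𝔼-map (bernoulli ℝ (1/2ε ½≤ε) m) replies (accept ∘ Adversary.corrupt adversary es))
              (𝔼-cong (bernoulli ℝ (1/2ε ½≤ε) m) λ bs → reflexive (accept-corrupt es bs))))
          (𝔼-flips (ε*1/2ε≈½ ½≤ε) as (accept ∘ uniqueGame)))

      advantage : ∀ η s → AdvantageAtLeast ℝ SR η A s → AdvantageAtLeast ℝ TT η reducing s
      advantage η s adv (lift (I , sat)) J noJ refl sizeJ =
        ≤-resp ≈-refl (+-cong (≈-sym yesValue) (-‿cong (≈-sym (accept-reducing J))))
          -- Each `uniqueGame cs` is a No instance of the same size as `J`, so the assumed advantage
          -- applies to every `cs` separately before averaging.
          (≤-minus⇒ (𝔼-½-≤ (TwoToTwoGame.m J) λ cs → ≤-minus⇒ (≤-resp ≈-refl (+-cong (semiRandom-uniform I sat) ≈-refl)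
            (adv (adversary I sat) (uniqueGame cs) (lift (soundness cs)) refl sizeJ))))
        where
        open Reduction J
        yesValue : 𝔼 ℝ (return ℝ I) (Pr-accept ℝ TT reducing) ≈ 𝔼 ℝ (bernoulli ℝ ½ (TwoToTwoGame.m I)) (accept ∘ Reduction.uniqueGame I)
        yesValue = ≈-trans (𝔼-return I (Pr-accept ℝ TT reducing)) (accept-reducing I)
        soundness : ∀ cs → AtMostSatisfiable ℝ δ (UniqueGame.satisfied (uniqueGame cs))
        soundness cs x = ≤-trans (fromℕ-mono-≤ (satisfied⊆ cs x)) (noJ x)

    transfer : ∀ r → Indistinguishable ℝ TT r → Indistinguishable ℝ SR r
    transfer almostAllSizes      ind A η 0<η (N , adv) = ind (reducing A) η 0<η (N , λ s s≥N → advantage A η s (adv s s≥N))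
    transfer infinitelyManySizes ind A η 0<η = let N , noAdv = ind (reducing A) η 0<η in
      N , λ s s≥N adv → noAdv s s≥N (advantage A η s adv)

theorem3p10 : ∀ {c ℓ₁ ℓ₂ ℓ₃} (ℝ : ArchimedeanOrderedField c ℓ₁ ℓ₂ ℓ₃) (r : Reading) →
    TwoToTwoConjecture ℝ r →
    let open ArchimedeanOrderedField ℝ in
    ∀ ε δ → ½ ≤ᴿ ε → ε ≤ᴿ 1# → 0# <ᴿ δ →
    Indistinguishable ℝ (SemiRandomUG ℝ ε δ) r
theorem3p10 ℝ r conjecture ε δ ½≤ε ε≤1 0<δ =
  let k₀ , hard = conjecture δ 0<δ in
  -- Doubling `k₀` gives a label number that is even and still at least `k₀`.
  Reduce.transfer ℝ ε δ ½≤ε (2 * k₀) r (hard (2 * k₀) (ℕ.m≤n*m k₀ 2) (m∣m*n k₀))
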